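{- For every positive integer $n$ there exists a staged assembly system with temperature $\tau=2$ that (uniquely) assembles a fully connected $n\times n$ square, using $\mathcal{O}(\log n)$ stages, $4$ glues, $14$ tile types and $7$ bins.
   Context: Staged assembly model (based on the two-handed assembly model). A tile is a non-rotatable unit square carrying a glue from a finite alphabet $\Sigma$ (which contains a special glue null) on each of its four sides (north, east, south, west). A tile system has a glue function $G:\Sigma\times\Sigma\to\{0,1,\dots,\tau\}$, symmetric, with $G(\mathrm{null},x)=0$, and a positive integer temperature $\tau$. A configuration places tiles on positions of $\mathbb{Z}^2$; a supertile is a maximal set of placed tiles that is connected in the grid adjacency graph (considered up to translation). Two supertiles $X,Y$ can combine if they can be placed adjacent without overlap so that the sum of the glue strengths over all newly coincident edges is at least $\tau$. A bin, started with a set of supertiles, produces all supertiles obtainable by repeated combination; its terminal supertiles are produced supertiles that cannot combine with any produced supertile. A staged assembly system with $r$ stages and $b$ bins is given by a mix graph: in stage 1 each bin receives a set of tile types; in stage $i\ge 2$ each bin receives the terminal supertiles of some bins of stage $i-1$, plus possibly new tile types; the output is the union of the terminal supertiles of selected bins of stage $r$. The system uniquely produces its output if the terminal supertiles in every bin are unique. Glue complexity is the number of non-null glues used, tile complexity the number of distinct tile types used, bin complexity $b$, stage complexity $r$. A supertile is fully connected if every two adjacent tiles in it share a positive-strength glue on their common edge. -}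

module Defs where

open import Data.Nat as ℕ using (ℕ; zero; suc; _≤_; _<_)
open import Data.Integer as ℤ using (ℤ; +_; 0ℤ; 1ℤ)
open import Data.Bool using (Bool; true; false)
open import Data.Fin using (Fin)
open import Data.List using (List; []; _∷_; _++_; map; length; concatMap)
open import Data.Nat.ListAction using (sum)
open import Data.List.Membership.Propositional using (_∈_; _∉_)
open import Data.List.Relation.Unary.All using (All)
open import Data.Product using (_×_; _,_; proj₁; proj₂; Σ; ∃; ∃-syntax)
open import Data.Sum using (_⊎_)
open import Data.Empty using (⊥)
open import Relation.Nullary using (¬_; yes; no)
open import Relation.Binary.PropositionalEquality using (_≡_; _≢_)
open import Data.Product.Properties using (≡-dec)

Glue : Set
Glue = ℕ

null : Glue
null = 0

-- A (non-rotatable) tile type: glues on north, east, south, west.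
record Tile : Set where
  constructor tile
  field
    north east south west : Glue
open Tile public

Pos : Set
Pos = ℤ × ℤ

_≟ᴾ_ : (p q : Pos) → Relation.Nullary.Dec (p ≡ q)
_≟ᴾ_ = ≡-dec ℤ._≟_ ℤ._≟_

-- A configuration: a finite list of placed tiles (position, tile type).
-- Supertiles are such configurations, considered up to translation
-- (see _≈ᵗ_ below).  Produced configurations never have two tiles on
-- the same position, since combination requires disjointness.
Config : Set
Config = List (Pos × Tile)

positions : Config → List Pos
positions = map proj₁

shift : Pos → Config → Config
shift (a , b) = map (λ { ((x , y) , t) → ((x ℤ.+ a , y ℤ.+ b) , t) })

_≈ᵗ_ : Config → Config → Set
X ≈ᵗ Y = ∃[ v ] (∀ e → (e ∈ shift v X → e ∈ Y) × (e ∈ Y → e ∈ shift v X))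

module _ (G : Glue → Glue → ℕ) where

  pairStrength : Pos × Tile → Pos × Tile → ℕ
  pairStrength ((x , y) , t) (q , u) with q ≟ᴾ (x ℤ.+ 1ℤ , y)
  ... | yes _ = G (east t) (west u)
  ... | no _ with q ≟ᴾ (x ℤ.- 1ℤ , y)
  ...   | yes _ = G (west t) (east u)
  ...   | no _ with q ≟ᴾ (x , y ℤ.+ 1ℤ)
  ...     | yes _ = G (north t) (south u)
  ...     | no _ with q ≟ᴾ (x , y ℤ.- 1ℤ)
  ...       | yes _ = G (south t) (north u)
  ...       | no _ = 0

  strength : Config → Config → ℕ
  strength X Y = sum (concatMap (λ e → map (pairStrength e) Y) X)

  FullyConnected : Config → Set
  FullyConnected X =
    ∀ {x y t u} → ((x , y) , t) ∈ X →
      (((x ℤ.+ 1ℤ , y) , u) ∈ X → 0 < G (east t) (west u)) ×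
      (((x , y ℤ.+ 1ℤ) , u) ∈ X → 0 < G (north t) (south u))

Disjoint : Config → Config → Set
Disjoint X Y = All (λ p → p ∉ positions Y) (positions X)

CombinesAt : (G : Glue → Glue → ℕ) (τ : ℕ) → Config → Config → Pos → Set
CombinesAt G τ X Y v = Disjoint X (shift v Y) × τ ≤ strength G X (shift v Y)

CanCombine : (G : Glue → Glue → ℕ) (τ : ℕ) → Config → Config → Set
CanCombine G τ X Y = ∃[ v ] CombinesAt G τ X Y v

data Prod (G : Glue → Glue → ℕ) (τ : ℕ) (Init : Config → Set) : Config → Set where
  init    : ∀ {X} → Init X → Prod G τ Init X
  combine : ∀ {X Y} v → Prod G τ Init X → Prod G τ Init Y →
            CombinesAt G τ X Y v → Prod G τ Init (X ++ shift v Y)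

single : Tile → Config
single t = ((0ℤ , 0ℤ) , t) ∷ []

-- Staged assembly systems.  Stages are indexed 0 … stages-1 (stage i
-- here is stage i+1 of the paper); bins by Fin bins.

record StagedSystem : Set where
  field
    τ        : ℕ
    τ-pos    : 1 ≤ τ
    G        : Glue → Glue → ℕ
    G-sym    : ∀ x y → G x y ≡ G y x
    G-null   : ∀ x → G null x ≡ 0
    G-bound  : ∀ x y → G x y ≤ τ
    stages   : ℕ
    stages-pos : 1 ≤ stages
    bins     : ℕ
    tilesIn  : ℕ → Fin bins → List Tile
    -- mix graph: at stage i+1, bin j receives the terminal supertiles of
    -- bin k of stage i iff mix (suc i) j k ≡ true  (mix 0 is unused)
    mix      : ℕ → Fin bins → Fin bins → Bool
    output   : Fin bins → Bool

module _ (S : StagedSystem) where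
  open StagedSystem S

  mutual
    Initial : ℕ → Fin bins → Config → Set
    Initial zero    j X = ∃[ t ] (t ∈ tilesIn zero j × X ≡ single t)
    Initial (suc i) j X = (∃[ t ] (t ∈ tilesIn (suc i) j × X ≡ single t))
                          ⊎ (∃[ k ] (mix (suc i) j k ≡ true × Terminal i k X))

    Produced : ℕ → Fin bins → Config → Set
    Produced i j = Prod G τ (Initial i j)

    Terminal : ℕ → Fin bins → Config → Set
    Terminal i j X = Produced i j X × (∀ Y → Produced i j Y → ¬ CanCombine G τ X Y)

  UniquelyProduces : Set
  UniquelyProduces = ∀ i j → i < stages → ∀ X Y →
    Terminal i j X → Terminal i j Y → X ≈ᵗ Y

  finalStage : ℕ
  finalStage = stages ℕ.∸ 1

  Output : Config → Set
  Output X = ∃[ j ] (output j ≡ true × Terminal finalStage j X)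

  TileComplexity≤ : ℕ → Set
  TileComplexity≤ m = ∃[ ts ] (length ts ≤ m ×
    (∀ i j t → i < stages → t ∈ tilesIn i j → t ∈ ts))

  GlueComplexity≤ : ℕ → Set
  GlueComplexity≤ m = ∃[ gs ] (length gs ≤ m ×
    (∀ i j t → i < stages → t ∈ tilesIn i j →
       All (λ g → g ≡ null ⊎ g ∈ gs) (north t ∷ east t ∷ south t ∷ west t ∷ [])))

IsSquare : ℕ → Config → Set
IsSquare n X = ∃[ o ] (∀ x y →
  ((x , y) ∈ positions (shift o X) →
     (0ℤ ℤ.≤ x × x ℤ.< + n) × (0ℤ ℤ.≤ y × y ℤ.< + n)) ×
  ((0ℤ ℤ.≤ x × x ℤ.< + n) × (0ℤ ℤ.≤ y × y ℤ.< + n) →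
     (x , y) ∈ positions (shift o X)))

{-# OPTIONS --safe #-}
-- A column and a row of m = n - 1 tiles, held together by strength-2 glues, are
-- joined by a corner tile to an L.  A tile carrying the strength-1 glue on all four
-- sides can then only attach to two tiles at once, hence only in the inner corners
-- of the L, and the closure of the L under such attachments is the n × n square.
-- The lines are grown along the binary expansion of m: with three line glues in
-- cyclic order, three bins hold the lines j → j + 1, and concatenating two
-- consecutive lines gives the lines j → j - 1 of twice the length.
--
-- All supertiles before the filling stage are paths with steps to the south and to
-- the east.  Such paths can only bind end to end, and x - y increases along them, so
-- consecutive paths never overlap.
module Submission where

open import Defs
import Data.Fin.Properties as Finₚ
import Data.Integer.Properties as ℤₚ
open import Algebra.Bundles using (AbelianGroup)
open import Data.Nat as ℕ using (ℕ; zero; suc; _≤_; _<_; _+_; _*_; ⌊_/2⌋; z≤n; s≤s)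
open import Data.Product.Properties using (≡-dec)
open import Algebra.Properties.Group (AbelianGroup.group ℤₚ.+-0-abelianGroup) using (identityʳ-unique; ∙-cancelˡ)
open import Data.Bool using (Bool; true; false; not)
open import Data.Empty using (⊥; ⊥-elim)
open import Data.Fin as Fin using (Fin; zero; suc; toℕ)
open import Data.Integer as ℤ using (ℤ; +_; 0ℤ; 1ℤ)
open import Data.Integer.Tactic.RingSolver using (solve-∀)
open import Data.List using (List; []; _∷_; _++_; map; length; allFin; cartesianProduct; cartesianProductWith)
open import Data.List.Membership.DecPropositional (≡-dec (Finₚ._≟_ {2}) (Finₚ._≟_ {3})) using () renaming (_∈?_ to _∈ᴮ?_)
open import Data.List.Membership.DecPropositional _≟ᴾ_ using (_∈?_)
open import Data.List.Membership.DecPropositional ℕ._≟_ using () renaming (_∈?_ to _∈ᴳ?_)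
open import Data.List.Membership.Propositional using (_∈_; _∉_)
open import Data.List.Membership.Propositional.Properties using (∈-map⁺; ∈-map⁻; ∈-++⁺ˡ; ∈-++⁺ʳ; ∈-++⁻; ∈-allFin; ∈-cartesianProduct⁺; ∈-cartesianProductWith⁺)
open import Data.List.Properties using (map-cong; map-++; map-∘; length-++)
open import Data.List.Relation.Unary.All as All using (All; []; _∷_)
open import Data.List.Relation.Unary.AllPairs using ([]; _∷_)
open import Data.List.Relation.Unary.Any using (here; there)
open import Data.List.Relation.Unary.Unique.Propositional using (Unique)
import Data.List.Relation.Unary.Unique.Propositional.Properties as Unique
open import Data.Nat.Induction using (<-rec)
open import Data.Nat.ListAction using (sum)
open import Data.Nat.ListAction.Properties using (sum-++)
open import Data.Nat.Logarithm using (⌊log₂_⌋; ⌊log₂⌋-mono-≤; ⌊log₂⌊n/2⌋⌋≡⌊log₂n⌋∸1)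
import Data.Nat.Properties as ℕₚ
open import Data.Product using (_×_; _,_; proj₁; proj₂; ∃; ∃-syntax; Σ-syntax)
open import Data.Sum as Sum using (_⊎_; inj₁; inj₂; [_,_]′)
open import Data.Unit using (⊤; tt)
open import Function using (id)
open import Relation.Binary.PropositionalEquality
open import Relation.Nullary using (¬_; Dec; does; yes; no; contradiction)
open import Relation.Nullary.Decidable using (dec-true; toWitness; _⊎-dec_)

-- Every bin holds unlimited copies, and terminal supertiles must be unique in every bin, not only
-- in the last. So a supertile must be inert against its own copies. A line with equal end glues
-- would chain without end. Joining two lines involves the two outer glues and the glue at the seam,
-- and these three must be pairwise distinct; three glues in cyclic order allow this, and the result
-- is again a line of the same kind with reversed orientation. Appending one tile also advances by
-- two glues, so both operations reverse the orientation, and tiles of both orientations are needed.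
-- In the filling stage the danger is that two partly filled squares bind to each other. The L
-- carries its weak glue on north and east sides only, and growth keeps every non-null west or south
-- side covered by a tile of the same supertile. Any contact uses a west or south side of one
-- partner, so two partial squares would have to overlap. The strong glues left at the ends of the L
-- are harmless, since no lines enter that bin.

-- Translations

infixl 6 _+ᴾ_

_+ᴾ_ : Pos → Pos → Pos
(x , y) +ᴾ (a , b) = x ℤ.+ a , y ℤ.+ b

-ᴾ_ : Pos → Pos
-ᴾ (x , y) = ℤ.- x , ℤ.- y

+ᴾ-assoc : ∀ p q r → (p +ᴾ q) +ᴾ r ≡ p +ᴾ (q +ᴾ r)
+ᴾ-assoc (a , b) (c , d) (e , f) = cong₂ _,_ (ℤₚ.+-assoc a c e) (ℤₚ.+-assoc b d f)

+ᴾ-comm : ∀ p q → p +ᴾ q ≡ q +ᴾ p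
+ᴾ-comm (a , b) (c , d) = cong₂ _,_ (ℤₚ.+-comm a c) (ℤₚ.+-comm b d)

+ᴾ-swap : ∀ p q r → (p +ᴾ q) +ᴾ r ≡ (p +ᴾ r) +ᴾ q
+ᴾ-swap p q r = begin
  (p +ᴾ q) +ᴾ r  ≡⟨ +ᴾ-assoc p q r ⟩
  p +ᴾ (q +ᴾ r)  ≡⟨ cong (p +ᴾ_) (+ᴾ-comm q r) ⟩
  p +ᴾ (r +ᴾ q)  ≡⟨ +ᴾ-assoc p r q ⟨
  (p +ᴾ r) +ᴾ q  ∎
  where open ≡-Reasoning

+ᴾ-inverseʳ : ∀ p v → (p +ᴾ v) +ᴾ (-ᴾ v) ≡ p
+ᴾ-inverseʳ (a , b) (c , d) = cong₂ _,_ (lemma a c) (lemma b d)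
  where
  lemma : ∀ x y → (x ℤ.+ y) ℤ.+ (ℤ.- y) ≡ x
  lemma = solve-∀

+ᴾ-inverseˡ : ∀ p v → (p +ᴾ (-ᴾ v)) +ᴾ v ≡ p
+ᴾ-inverseˡ p v = trans (+ᴾ-swap p (-ᴾ v) v) (+ᴾ-inverseʳ p v)

+ᴾ-cancelʳ : ∀ v {p q} → p +ᴾ v ≡ q +ᴾ v → p ≡ q
+ᴾ-cancelʳ v {p} {q} eq = trans (sym (+ᴾ-inverseʳ p v)) (trans (cong (_+ᴾ (-ᴾ v)) eq) (+ᴾ-inverseʳ q v))

_⟶_ : Pos → Pos → Pos
p ⟶ q = (-ᴾ p) +ᴾ q

+ᴾ-⟶ : ∀ p q → p +ᴾ (p ⟶ q) ≡ q
+ᴾ-⟶ (a , b) (c , d) = cong₂ _,_ (lemma a c) (lemma b d)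
  where
  lemma : ∀ x y → x ℤ.+ ((ℤ.- x) ℤ.+ y) ≡ y
  lemma = solve-∀

⟶-+ᴾ : ∀ p q v → (p +ᴾ v) +ᴾ (p ⟶ q) ≡ q +ᴾ v
⟶-+ᴾ p q v = trans (+ᴾ-swap p v (p ⟶ q)) (cong (_+ᴾ v) (+ᴾ-⟶ p q))

∈-shift⁺ : ∀ v {X p t} → (p , t) ∈ X → (p +ᴾ v , t) ∈ shift v X
∈-shift⁺ v = ∈-map⁺ _

∈-shift⁻ : ∀ v {X q t} → (q , t) ∈ shift v X → ∃[ p ] (q ≡ p +ᴾ v × (p , t) ∈ X)
∈-shift⁻ v e∈ with ((p , _) , e∈X , refl) ← ∈-map⁻ _ e∈ = p , refl , e∈X

∈-positions⁺ : ∀ {X p t} → (p , t) ∈ X → p ∈ positions X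
∈-positions⁺ = ∈-map⁺ proj₁

∈-positions⁻ : ∀ {X p} → p ∈ positions X → ∃[ t ] (p , t) ∈ X
∈-positions⁻ p∈ with ((_ , t) , e∈X , refl) ← ∈-map⁻ proj₁ p∈ = t , e∈X

infix 4 _≐_

-- Agreement as sets of placed tiles. The order of the list records the history of assembly, which
-- varies between runs and is ignored by `_≈ᵗ_` as well.
_≐_ : Config → Config → Set
X ≐ Y = ∀ e → (e ∈ X → e ∈ Y) × (e ∈ Y → e ∈ X)

≐-shift : ∀ v {X Y} → X ≐ Y → shift v X ≐ shift v Y
≐-shift v X≐Y (q , t) =
    (λ e∈ → let (p , q≡ , p∈) = ∈-shift⁻ v e∈ in
       subst (λ q → (q , t) ∈ _) (sym q≡) (∈-shift⁺ v (proj₁ (X≐Y (p , t)) p∈)))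
  , (λ e∈ → let (p , q≡ , p∈) = ∈-shift⁻ v e∈ in
       subst (λ q → (q , t) ∈ _) (sym q≡) (∈-shift⁺ v (proj₂ (X≐Y (p , t)) p∈)))

≐-++ : ∀ {X Y X′ Y′} → X ≐ X′ → Y ≐ Y′ → X ++ Y ≐ X′ ++ Y′
≐-++ {X} {Y} {X′} {Y′} X≐ Y≐ e =
    (λ e∈ → [ (λ e∈X → ∈-++⁺ˡ (proj₁ (X≐ e) e∈X)) , (λ e∈Y → ∈-++⁺ʳ X′ (proj₁ (Y≐ e) e∈Y)) ]′ (∈-++⁻ X e∈))
  , (λ e∈ → [ (λ e∈X → ∈-++⁺ˡ (proj₂ (X≐ e) e∈X)) , (λ e∈Y → ∈-++⁺ʳ X (proj₂ (Y≐ e) e∈Y)) ]′ (∈-++⁻ X′ e∈))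

∈-++-swap : ∀ X {Y} {e : Pos × Tile} → e ∈ X ++ Y → e ∈ Y ++ X
∈-++-swap X {Y} e∈ = [ ∈-++⁺ʳ Y , ∈-++⁺ˡ ]′ (∈-++⁻ X e∈)

-- Positions occurring once

Apart : Config → Config → Set
Apart X Y = ∀ {p} → p ∈ positions X → p ∈ positions Y → ⊥

disjoint⇒apart : ∀ {X Y} → Disjoint X Y → Apart X Y
disjoint⇒apart d p∈X p∈Y = All.lookup d p∈X p∈Y

apart⇒disjoint : ∀ {X Y} → Apart X Y → Disjoint X Y
apart⇒disjoint a = All.tabulate (λ p∈X p∈Y → a p∈X p∈Y)

positions-++ : ∀ X Y → positions (X ++ Y) ≡ positions X ++ positions Y
positions-++ = map-++ proj₁

positions-shift : ∀ v X → positions (shift v X) ≡ map (_+ᴾ v) (positions X)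
positions-shift v X = trans (sym (map-∘ X)) (map-∘ X)

unique-tile : ∀ {X p t u} → Unique (positions X) → (p , t) ∈ X → (p , u) ∈ X → t ≡ u
unique-tile _        (here refl) (here refl) = refl
unique-tile (p∉ ∷ _) (here refl) (there u∈)  = ⊥-elim (All.lookup p∉ (∈-positions⁺ u∈) refl)
unique-tile (p∉ ∷ _) (there t∈)  (here refl) = ⊥-elim (All.lookup p∉ (∈-positions⁺ t∈) refl)
unique-tile (_ ∷ uX) (there t∈)  (there u∈)  = unique-tile uX t∈ u∈

-- `strength` sums over list entries, so a repeated entry would be counted twice. This excludes it,
-- and it makes the tile at a position well defined.
Prod-unique : ∀ {G τ Init} → (∀ {X} → Init X → Unique (positions X)) →
              ∀ {X} → Prod G τ Init X → Unique (positions X)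
Prod-unique initial (init X∈) = initial X∈
Prod-unique initial (combine {X} {Y} v X∈ Y∈ (d , _)) =
  subst Unique (sym (positions-++ X (shift v Y)))
    (Unique.++⁺ (Prod-unique initial X∈)
                (subst Unique (sym (positions-shift v Y))
                  (Unique.map⁺ (+ᴾ-cancelʳ v) (Prod-unique initial Y∈)))
                (λ (p∈X , p∈Y) → disjoint⇒apart {X} {shift v Y} d p∈X p∈Y))

module _ (S : StagedSystem) where

  Initial-unique : ∀ i j {X} → Initial S i j X → Unique (positions X)
  Initial-unique zero    j (_ , _ , refl)               = [] ∷ []
  Initial-unique (suc i) j (inj₁ (_ , _ , refl))        = [] ∷ []
  Initial-unique (suc i) j (inj₂ (k , _ , X∈ , _)) = Prod-unique (Initial-unique i k) X∈

-- Glue strengths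

bond : Glue → ℕ
bond 1 = 2
bond 2 = 2
bond 3 = 2
bond 4 = 1
bond _ = 0

G : Glue → Glue → ℕ
G x y with x ℕ.≟ y
... | yes _ = bond x
... | no  _ = 0

G-refl : ∀ x → G x x ≡ bond x
G-refl x with x ℕ.≟ x
... | yes _  = refl
... | no x≢x = contradiction refl x≢x

G-positive : ∀ {x y} → 0 < G x y → x ≡ y
G-positive {x} {y} 0<G with x ℕ.≟ y
... | yes x≡y = x≡y

G-sym : ∀ x y → G x y ≡ G y x
G-sym x y with x ℕ.≟ y
... | yes refl = sym (G-refl x)
... | no x≢y with y ℕ.≟ x
...   | yes refl = contradiction refl x≢y
...   | no _     = refl

G-null : ∀ x → G null x ≡ 0
G-null x with 0 ℕ.≟ x
... | yes _ = refl
... | no _  = refl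

bond≤2 : ∀ x → bond x ≤ 2
bond≤2 0 = z≤n
bond≤2 1 = ℕₚ.≤-refl
bond≤2 2 = ℕₚ.≤-refl
bond≤2 3 = ℕₚ.≤-refl
bond≤2 4 = s≤s z≤n
bond≤2 (suc (suc (suc (suc (suc _))))) = z≤n

G≤2 : ∀ x y → G x y ≤ 2
G≤2 x y with x ℕ.≟ y
... | yes _ = bond≤2 x
... | no _  = z≤n

G-weak : ∀ x → G x 4 ≤ 1
G-weak x with x ℕ.≟ 4
... | yes refl = ℕₚ.≤-refl
... | no _     = z≤n

-- Contacts between placed tiles

right up : Pos
right = 1ℤ , 0ℤ
up    = 0ℤ , 1ℤ

-- The strength is always written with the east or north glue first, so that exchanging the two
-- tiles only exchanges constructors.
data Contact : Pos × Tile → Pos × Tile → ℕ → Set where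
  eastward  : ∀ {p q t u} → q ≡ p +ᴾ right → Contact (p , t) (q , u) (G (east t) (west u))
  westward  : ∀ {p q t u} → p ≡ q +ᴾ right → Contact (p , t) (q , u) (G (east u) (west t))
  northward : ∀ {p q t u} → q ≡ p +ᴾ up → Contact (p , t) (q , u) (G (north t) (south u))
  southward : ∀ {p q t u} → p ≡ q +ᴾ up → Contact (p , t) (q , u) (G (north u) (south t))

Contact-sym : ∀ {e f k} → Contact e f k → Contact f e k
Contact-sym (eastward eq)  = westward eq
Contact-sym (westward eq)  = eastward eq
Contact-sym (northward eq) = southward eq
Contact-sym (southward eq) = northward eq

fixed : ∀ {x k} → x ≡ x ℤ.+ k → k ≡ 0ℤ
fixed {x} {k} eq = identityʳ-unique x k (sym eq)

plus-minus : ∀ x → x ≡ (x ℤ.+ 1ℤ) ℤ.- 1ℤ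
plus-minus = solve-∀

minus-plus : ∀ x → x ≡ (x ℤ.- 1ℤ) ℤ.+ 1ℤ
minus-plus = solve-∀

two-apart : ∀ x → (x ℤ.+ 1ℤ) ℤ.+ 1ℤ ≡ x ℤ.+ (+ 2)
two-apart = solve-∀

x≢x+1 : ∀ {x} → x ≢ x ℤ.+ 1ℤ
x≢x+1 eq with () ← fixed eq

x≢x-1 : ∀ {x} → x ≢ x ℤ.- 1ℤ
x≢x-1 eq with () ← fixed eq

x≢x+2 : ∀ {x} → x ≢ (x ℤ.+ 1ℤ) ℤ.+ 1ℤ
x≢x+2 {x} eq with () ← fixed (trans eq (two-apart x))

contact : ∀ e f → pairStrength G e f ≡ 0 ⊎ ∃[ k ] (pairStrength G e f ≡ k × Contact e f k)
contact ((x , y) , t) (q , u) with q ≟ᴾ (x ℤ.+ 1ℤ , y)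
... | yes refl = inj₂ (_ , refl , eastward (cong (_ ,_) (sym (ℤₚ.+-identityʳ y))))
... | no _ with q ≟ᴾ (x ℤ.- 1ℤ , y)
...   | yes refl = inj₂ (_ , G-sym (west t) (east u) , westward (cong₂ _,_ (minus-plus x) (sym (ℤₚ.+-identityʳ y))))
...   | no _ with q ≟ᴾ (x , y ℤ.+ 1ℤ)
...     | yes refl = inj₂ (_ , refl , northward (cong (_, _) (sym (ℤₚ.+-identityʳ x))))
...     | no _ with q ≟ᴾ (x , y ℤ.- 1ℤ)
...       | yes refl = inj₂ (_ , G-sym (south t) (north u) , southward (cong₂ _,_ (sym (ℤₚ.+-identityʳ x)) (minus-plus y)))
...       | no _ = inj₁ refl

private
  -- `pairStrength` tests the four neighbours in a fixed order, so each direction must refute the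
  -- tests that precede its own.
  pairStrength-east : ∀ x y t u → pairStrength G ((x , y) , t) ((x ℤ.+ 1ℤ , y) , u) ≡ G (east t) (west u)
  pairStrength-east x y t u with (x ℤ.+ 1ℤ , y) ≟ᴾ (x ℤ.+ 1ℤ , y)
  ... | yes _  = refl
  ... | no neq = contradiction refl neq

  pairStrength-west : ∀ x y t u → pairStrength G ((x ℤ.+ 1ℤ , y) , u) ((x , y) , t) ≡ G (east t) (west u)
  pairStrength-west x y t u with (x , y) ≟ᴾ ((x ℤ.+ 1ℤ) ℤ.+ 1ℤ , y)
  ... | yes eq = contradiction (cong proj₁ eq) x≢x+2
  ... | no _ with (x , y) ≟ᴾ ((x ℤ.+ 1ℤ) ℤ.- 1ℤ , y)
  ...   | yes _  = G-sym (west u) (east t)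
  ...   | no neq = contradiction (cong (_, y) (plus-minus x)) neq

  pairStrength-north : ∀ x y t u → pairStrength G ((x , y) , t) ((x , y ℤ.+ 1ℤ) , u) ≡ G (north t) (south u)
  pairStrength-north x y t u with (x , y ℤ.+ 1ℤ) ≟ᴾ (x ℤ.+ 1ℤ , y)
  ... | yes eq = contradiction (cong proj₁ eq) x≢x+1
  ... | no _ with (x , y ℤ.+ 1ℤ) ≟ᴾ (x ℤ.- 1ℤ , y)
  ...   | yes eq = contradiction (cong proj₁ eq) x≢x-1
  ...   | no _ with (x , y ℤ.+ 1ℤ) ≟ᴾ (x , y ℤ.+ 1ℤ)
  ...     | yes _  = refl
  ...     | no neq = contradiction refl neq

  pairStrength-south : ∀ x y t u → pairStrength G ((x , y ℤ.+ 1ℤ) , u) ((x , y) , t) ≡ G (north t) (south u)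
  pairStrength-south x y t u with (x , y) ≟ᴾ (x ℤ.+ 1ℤ , y ℤ.+ 1ℤ)
  ... | yes eq = contradiction (cong proj₁ eq) x≢x+1
  ... | no _ with (x , y) ≟ᴾ (x ℤ.- 1ℤ , y ℤ.+ 1ℤ)
  ...   | yes eq = contradiction (cong proj₁ eq) x≢x-1
  ...   | no _ with (x , y) ≟ᴾ (x , (y ℤ.+ 1ℤ) ℤ.+ 1ℤ)
  ...     | yes eq = contradiction (cong proj₂ eq) x≢x+2
  ...     | no _ with (x , y) ≟ᴾ (x , (y ℤ.+ 1ℤ) ℤ.- 1ℤ)
  ...       | yes _  = G-sym (south u) (north t)
  ...       | no neq = contradiction (cong (x ,_) (plus-minus y)) neq

contact-strength : ∀ {e f k} → Contact e f k → pairStrength G e f ≡ k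
contact-strength (eastward {x , y} {_} {t} {u} refl)
  rewrite ℤₚ.+-identityʳ y = pairStrength-east x y t u
contact-strength (westward {_} {x , y} {u} {t} refl)
  rewrite ℤₚ.+-identityʳ y = pairStrength-west x y t u
contact-strength (northward {x , y} {_} {t} {u} refl)
  rewrite ℤₚ.+-identityʳ x = pairStrength-north x y t u
contact-strength (southward {_} {x , y} {u} {t} refl)
  rewrite ℤₚ.+-identityʳ x = pairStrength-south x y t u

pairStrength-sym : ∀ e f → pairStrength G e f ≡ pairStrength G f e
pairStrength-sym e f with contact e f
... | inj₂ (_ , eq , c) = trans eq (sym (contact-strength (Contact-sym c)))
... | inj₁ eq with contact f e
...   | inj₁ eq′          = trans eq (sym eq′)
...   | inj₂ (_ , eq′ , c) = trans (contact-strength (Contact-sym c)) (sym eq′)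

positive-contact : ∀ e f → 0 < pairStrength G e f → ∃[ k ] (0 < k × Contact e f k)
positive-contact e f 0<s with contact e f
... | inj₁ eq           = contradiction (subst (0 <_) eq 0<s) (λ ())
... | inj₂ (k , eq , c) = k , subst (0 <_) eq 0<s , c

-- Strengths of configurations

module _ {A : Set} (s : A → ℕ) where

  sum-positive : ∀ xs → 0 < sum (map s xs) → ∃[ x ] (x ∈ xs × 0 < s x)
  sum-positive (x ∷ xs) 0<sum with s x in eq
  ... | suc _ = x , here refl , subst (0 <_) (sym eq) (s≤s z≤n)
  ... | zero  = let (y , y∈ , 0<y) = sum-positive xs 0<sum in y , there y∈ , 0<y

  ∈⇒≤sum : ∀ {x xs} → x ∈ xs → s x ≤ sum (map s xs)
  ∈⇒≤sum (here refl)             = ℕₚ.m≤m+n _ _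
  ∈⇒≤sum {xs = y ∷ _} (there x∈) = ℕₚ.≤-trans (∈⇒≤sum x∈) (ℕₚ.m≤n+m _ (s y))

  distinct⇒2≤sum : ∀ {x y xs} → x ∈ xs → y ∈ xs → x ≢ y → 0 < s x → 0 < s y → 2 ≤ sum (map s xs)
  distinct⇒2≤sum (here refl) (here refl) x≢y _ _ = contradiction refl x≢y
  distinct⇒2≤sum (here refl) (there y∈) _ 0<x 0<y = ℕₚ.+-mono-≤ 0<x (ℕₚ.≤-trans 0<y (∈⇒≤sum y∈))
  distinct⇒2≤sum (there x∈) (here refl) _ 0<x 0<y = ℕₚ.+-mono-≤ 0<y (ℕₚ.≤-trans 0<x (∈⇒≤sum x∈))
  distinct⇒2≤sum {xs = z ∷ _} (there x∈) (there y∈) x≢y 0<x 0<y =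
    ℕₚ.≤-trans (distinct⇒2≤sum x∈ y∈ x≢y 0<x 0<y) (ℕₚ.m≤n+m _ (s z))

-- With every summand at most 1, a sum of 2 needs two list entries, and `Unique` puts them at
-- different positions.
two-contributors : ∀ (s : Pos × Tile → ℕ) → (∀ e → s e ≤ 1) → ∀ X → Unique (positions X) →
                   2 ≤ sum (map s X) →
                   ∃[ e ] ∃[ f ] (e ∈ X × f ∈ X × proj₁ e ≢ proj₁ f × 0 < s e × 0 < s f)
two-contributors s s≤1 (e ∷ X) (e∉ ∷ uX) 2≤sum with s e in eq | s≤1 e
... | zero | _ =
  let (f , g , f∈ , g∈ , f≢g , 0<f , 0<g) = two-contributors s s≤1 X uX 2≤sum
  in f , g , there f∈ , there g∈ , f≢g , 0<f , 0<g
... | suc zero | _ =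
  let (f , f∈ , 0<f) = sum-positive s X (ℕₚ.≤-pred 2≤sum)
  in e , f , here refl , there f∈ , All.lookup e∉ (∈-positions⁺ f∈) , subst (0 <_) (sym eq) (s≤s z≤n) , 0<f
... | suc (suc _) | s≤s ()

strength-∷ˡ : ∀ e X Y → strength G (e ∷ X) Y ≡ sum (map (pairStrength G e) Y) + strength G X Y
strength-∷ˡ e X Y = sum-++ (map (pairStrength G e) Y) _

strength-[]ʳ : ∀ X → strength G X [] ≡ 0
strength-[]ʳ []      = refl
strength-[]ʳ (e ∷ X) = strength-[]ʳ X

-- `strength` recurses on its first argument; this is the transposed recursion, from which symmetry
-- follows.
strength-∷ʳ : ∀ X f Y → strength G X (f ∷ Y) ≡ sum (map (λ e → pairStrength G e f) X) + strength G X Y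
strength-∷ʳ []      f Y = refl
strength-∷ʳ (e ∷ X) f Y = begin
  strength G (e ∷ X) (f ∷ Y)      ≡⟨ strength-∷ˡ e X (f ∷ Y) ⟩
  (a + b) + strength G X (f ∷ Y)  ≡⟨ cong (_+_ (a + b)) (strength-∷ʳ X f Y) ⟩
  (a + b) + (c + d)               ≡⟨ +-interchange a b c d ⟩
  (a + c) + (b + d)               ≡⟨ cong (_+_ (a + c)) (strength-∷ˡ e X Y) ⟨
  (a + c) + strength G (e ∷ X) Y  ∎
  where
  open ≡-Reasoning
  open import Algebra.Properties.CommutativeSemigroup ℕₚ.+-commutativeSemigroup
    using () renaming (interchange to +-interchange)
  a = pairStrength G e f
  b = sum (map (pairStrength G e) Y)
  c = sum (map (λ e → pairStrength G e f) X)
  d = strength G X Y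

strength-sym : ∀ X Y → strength G X Y ≡ strength G Y X
strength-sym []      Y = sym (strength-[]ʳ Y)
strength-sym (e ∷ X) Y = begin
  strength G (e ∷ X) Y                                    ≡⟨ strength-∷ˡ e X Y ⟩
  sum (map (pairStrength G e) Y) + strength G X Y         ≡⟨ cong₂ _+_ (cong sum (map-cong (pairStrength-sym e) Y)) (strength-sym X Y) ⟩
  sum (map (λ f → pairStrength G f e) Y) + strength G Y X ≡⟨ strength-∷ʳ Y e X ⟨
  strength G Y (e ∷ X)                                    ∎
  where open ≡-Reasoning

strength-[-] : ∀ X f → strength G X (f ∷ []) ≡ sum (map (λ e → pairStrength G e f) X)
strength-[-] X f = trans (strength-∷ʳ X f []) (trans (cong (_+_ _) (strength-[]ʳ X)) (ℕₚ.+-identityʳ _))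

pairStrength≤strength : ∀ {e f X Y} → e ∈ X → f ∈ Y → pairStrength G e f ≤ strength G X Y
pairStrength≤strength {e} {f} {e ∷ X} {Y} (here refl) f∈ =
  subst (_ ≤_) (sym (strength-∷ˡ e X Y)) (ℕₚ.≤-trans (∈⇒≤sum (pairStrength G e) f∈) (ℕₚ.m≤m+n _ _))
pairStrength≤strength {e} {f} {g ∷ X} {Y} (there e∈) f∈ =
  subst (_ ≤_) (sym (strength-∷ˡ g X Y)) (ℕₚ.≤-trans (pairStrength≤strength e∈ f∈) (ℕₚ.m≤n+m _ _))

strength-positive : ∀ X Y → 0 < strength G X Y →
                    ∃[ e ] ∃[ f ] ∃[ k ] (e ∈ X × f ∈ Y × 0 < k × Contact e f k)
strength-positive (e ∷ X) Y 0<s with sum (map (pairStrength G e) Y) in eq | subst (0 <_) (strength-∷ˡ e X Y) 0<s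
... | zero  | 0<s′ =
  let (e′ , f , k , e∈ , f∈ , 0<k , c) = strength-positive X Y 0<s′
  in e′ , f , k , there e∈ , f∈ , 0<k , c
... | suc _ | _ =
  let (f , f∈ , 0<f) = sum-positive (pairStrength G e) Y (subst (0 <_) (sym eq) (s≤s z≤n))
      (k , 0<k , c)  = positive-contact e f 0<f
  in e , f , k , here refl , f∈ , 0<k , c

-- `CombinesAt G 2 X Y v` is by definition `Attaches X (shift v Y)`. Absorbing the translation makes
-- the relation symmetric.
Attaches : Config → Config → Set
Attaches X Y = Disjoint X Y × 2 ≤ strength G X Y

Attaches-sym : ∀ {X Y} → Attaches X Y → Attaches Y X
Attaches-sym {X} {Y} (d , 2≤s) =
  apart⇒disjoint {Y} {X} (λ p∈Y p∈X → disjoint⇒apart {X} {Y} d p∈X p∈Y) , subst (2 ≤_) (strength-sym X Y) 2≤s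

TerminalIn : (Config → Set) → Config → Set
TerminalIn Init X = Prod G 2 Init X × (∀ Y → Prod G 2 Init Y → ¬ CanCombine G 2 X Y)

-- Monotone paths

Dir : Set
Dir = Fin 2

pattern vert  = zero
pattern horiz = suc zero

-- A port is a line glue together with the direction in which a path crosses it.
Port : Set
Port = Dir × Fin 3

step : Dir → Pos
step vert  = -ᴾ up
step horiz = right

lineGlue : Fin 3 → Glue
lineGlue j = suc (toℕ j)

northOf southOf eastOf westOf : Port → Glue
northOf (vert  , j) = lineGlue j
northOf (horiz , j) = 4
southOf (vert  , j) = lineGlue j
southOf (horiz , j) = null
eastOf  (vert  , j) = 4
eastOf  (horiz , j) = lineGlue j
westOf  (vert  , j) = null
westOf  (horiz , j) = lineGlue j

-- A path enters the tile through p (from the north or west) and leaves it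
-- through q (to the south or east); a north or east side it does not use carries
-- the weak glue 4, a south or west one is null.
pathTile : Port → Port → Tile
pathTile p q = tile (northOf p) (eastOf q) (southOf q) (westOf p)

-- Generic in the vertices: a line is a path over `Fin 3`, which `along` reads in either direction.
-- There is no empty path, so a first and a last tile always exist.
data Path {A : Set} : A → A → Set where
  edge : ∀ p q → Path p q
  _◂_  : ∀ p {q r} → Path q r → Path p r

infixr 5 _◂_ _▸_

_▸_ : ∀ {A : Set} {p q r : A} → Path p q → Path q r → Path p r
edge p q ▸ w′ = p ◂ w′
(p ◂ w)  ▸ w′ = p ◂ (w ▸ w′)

size : ∀ {A : Set} {p q : A} → Path p q → ℕ
size (edge _ _) = 1
size (_ ◂ w)    = suc (size w)

size-▸ : ∀ {A : Set} {p q r : A} (w : Path p q) (w′ : Path q r) → size (w ▸ w′) ≡ size w + size w′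
size-▸ (edge _ _) w′ = refl
size-▸ (p ◂ w)    w′ = cong suc (size-▸ w w′)

along : ∀ d {j k} → Path j k → Path {Port} (d , j) (d , k)
along d (edge j k) = edge (d , j) (d , k)
along d (j ◂ w)    = (d , j) ◂ along d w

along-▸ : ∀ d {j k l} (w : Path j k) (w′ : Path k l) → along d (w ▸ w′) ≡ along d w ▸ along d w′
along-▸ d (edge _ _) w′ = refl
along-▸ d (j ◂ w)    w′ = cong ((d , j) ◂_) (along-▸ d w w′)

place : ∀ {p q} → Pos → Path p q → Config
place o (edge p q)      = (o , pathTile p q) ∷ []
place o (_◂_ p {q} w) = (o , pathTile p q) ∷ place (o +ᴾ step (proj₁ q)) w

-- One step past the last tile, hence where a continuation must start.
exit : ∀ {p q : Port} → Pos → Path p q → Pos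
exit o (edge p q)      = o +ᴾ step (proj₁ q)
exit o (_◂_ p {q} w) = exit (o +ᴾ step (proj₁ q)) w

place-▸ : ∀ o {p q r} (w : Path p q) (w′ : Path q r) → place o (w ▸ w′) ≡ place o w ++ place (exit o w) w′
place-▸ o (edge p q) w′ = refl
place-▸ o (p ◂ w)    w′ = cong (_ ∷_) (place-▸ _ w w′)

exit-▸ : ∀ o {p q r : Port} (w : Path p q) (w′ : Path q r) → exit o (w ▸ w′) ≡ exit (exit o w) w′
exit-▸ o (edge p q) w′ = refl
exit-▸ o (p ◂ w)    w′ = exit-▸ _ w w′

place-shift : ∀ v o {p q} (w : Path p q) → shift v (place o w) ≡ place (o +ᴾ v) w
place-shift v o (edge p q) = refl
place-shift v o (_◂_ p {q} w) = cong (_ ∷_)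
  (trans (place-shift v _ w) (cong (λ o → place o w) (+ᴾ-swap o (step (proj₁ q)) v)))

-- `succ` keeps the following tile itself, because the glue checks on the finished square need its
-- entry port. For `pred` a position is enough, since it only serves to contradict disjointness.
record Node {p r} (o : Pos) (w : Path p r) (e : Pos × Tile) : Set where
  constructor node
  field
    {enter leave} : Port
    shape : proj₂ e ≡ pathTile enter leave
    succ  : (∃[ q ] (proj₁ e +ᴾ step (proj₁ leave) , pathTile leave q) ∈ place o w)
            ⊎ (leave ≡ r × proj₁ e +ᴾ step (proj₁ leave) ≡ exit o w)
    pred  : (enter ≡ p × proj₁ e ≡ o)
            ⊎ (∃[ π ] (π ∈ positions (place o w) × proj₁ e ≡ π +ᴾ step (proj₁ enter)))

place-head : ∀ o {p r} (w : Path p r) → ∃[ q ] (o , pathTile p q) ∈ place o w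
place-head o (edge p q)    = q , here refl
place-head o (_◂_ p {q} w) = q , here refl

place-last : ∀ o {p r} (w : Path p r) → ∃[ π ] ∃[ q ] (exit o w ≡ π +ᴾ step (proj₁ r) × (π , pathTile q r) ∈ place o w)
place-last o (edge p q) = o , p , refl , here refl
place-last o (p ◂ w)    = let (π , q , eq , π∈) = place-last _ w in π , q , eq , there π∈

nodeAt : ∀ o {p r} (w : Path p r) {e} → e ∈ place o w → Node o w e
nodeAt o (edge p q) (here refl) = node refl (inj₂ (refl , refl)) (inj₁ (refl , refl))
nodeAt o (p ◂ w) (here refl) =
  node refl (inj₁ (let (q , q∈) = place-head _ w in q , there q∈)) (inj₁ (refl , refl))
nodeAt o (_◂_ p {q} w) (there e∈) with nodeAt _ w e∈
... | node sh succ pred = node sh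
  (Sum.map₁ (λ (q , q∈) → q , there q∈) succ)
  (inj₂ ([ (λ (eq , eq′) → o , here refl , trans eq′ (cong (λ q → o +ᴾ step (proj₁ q)) (sym eq)))
         , (λ (π , π∈ , eq) → π , there π∈ , eq) ]′ pred))

rank : Pos → ℤ
rank (x , y) = x ℤ.- y

rank-step : ∀ p d → rank (p +ᴾ step d) ≡ ℤ.suc (rank p)
rank-step (x , y) vert  = lemma x y
  where
  lemma : ∀ x y → (x ℤ.+ 0ℤ) ℤ.- (y ℤ.+ ℤ.- 1ℤ) ≡ 1ℤ ℤ.+ (x ℤ.- y)
  lemma = solve-∀
rank-step (x , y) horiz = lemma x y
  where
  lemma : ∀ x y → (x ℤ.+ 1ℤ) ℤ.- (y ℤ.+ 0ℤ) ≡ 1ℤ ℤ.+ (x ℤ.- y)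
  lemma = solve-∀

rank<step : ∀ p d → rank p ℤ.< rank (p +ᴾ step d)
rank<step p d = subst (rank p ℤ.<_) (sym (rank-step p d)) (ℤₚ.suc[i]≤j⇒i<j ℤₚ.≤-refl)

rank<exit : ∀ o {p r} (w : Path p r) {π} → π ∈ positions (place o w) → rank π ℤ.< rank (exit o w)
rank<exit o (edge p q)    (here refl) = rank<step o (proj₁ q)
rank<exit o (_◂_ p {q} w) (here refl) =
  ℤₚ.<-trans (rank<step o (proj₁ q)) (rank<exit _ w (∈-positions⁺ (proj₂ (place-head _ w))))
rank<exit o (p ◂ w)       (there π∈)  = rank<exit _ w π∈

entry≤rank : ∀ o {p r} (w : Path p r) {π} → π ∈ positions (place o w) → rank o ℤ.≤ rank π
entry≤rank o (edge p q)    (here refl) = ℤₚ.≤-refl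
entry≤rank o (p ◂ w)       (here refl) = ℤₚ.≤-refl
entry≤rank o (_◂_ p {q} w) (there π∈)  = ℤₚ.≤-trans (ℤₚ.<⇒≤ (rank<step o (proj₁ q))) (entry≤rank _ w π∈)

lineGlue-injective : ∀ {i j} → lineGlue i ≡ lineGlue j → i ≡ j
lineGlue-injective eq = Finₚ.toℕ-injective (ℕₚ.suc-injective eq)

lineGlue≢4 : ∀ {j} → lineGlue j ≢ 4
lineGlue≢4 {zero} ()
lineGlue≢4 {suc zero} ()
lineGlue≢4 {suc (suc zero)} ()

bond-line : ∀ j → bond (lineGlue j) ≡ 2
bond-line zero             = refl
bond-line (suc zero)       = refl
bond-line (suc (suc zero)) = refl

G-line : ∀ j → G (lineGlue j) (lineGlue j) ≡ 2
G-line j = trans (G-refl (lineGlue j)) (bond-line j)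

-- An east side is weak or a line glue, a west side null or a line glue, so equal glues are line
-- glues. Hence the weak glue never binds two path tiles, and columns and rows can share the same
-- three line glues.
east-west-match : ∀ q p → eastOf q ≡ westOf p → q ≡ p × proj₁ q ≡ horiz
east-west-match (vert  , _) (vert  , _) ()
east-west-match (vert  , _) (horiz , a) eq = contradiction (sym eq) (lineGlue≢4 {a})
east-west-match (horiz , _) (vert  , _) ()
east-west-match (horiz , _) (horiz , _) eq = cong (horiz ,_) (lineGlue-injective eq) , refl

north-south-match : ∀ p q → northOf p ≡ southOf q → q ≡ p × proj₁ q ≡ vert
north-south-match (vert  , _) (vert  , _) eq = cong (vert ,_) (lineGlue-injective (sym eq)) , refl
north-south-match (vert  , _) (horiz , _) ()
north-south-match (horiz , _) (vert  , a) eq = contradiction (sym eq) (lineGlue≢4 {a})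
north-south-match (horiz , _) (horiz , _) ()

path-contact : ∀ {π π′ p q p′ q′ k} → 0 < k → Contact (π , pathTile p q) (π′ , pathTile p′ q′) k →
               (q ≡ p′ × π′ ≡ π +ᴾ step (proj₁ q)) ⊎ (q′ ≡ p × π ≡ π′ +ᴾ step (proj₁ q′))
path-contact {π} {π′} {p} {q} {p′} {q′} 0<k (eastward eq)
  with east-west-match q p′ (G-positive 0<k)
... | refl , refl = inj₁ (refl , eq)
path-contact {π} {π′} {p} {q} {p′} {q′} 0<k (westward eq)
  with east-west-match q′ p (G-positive 0<k)
... | refl , refl = inj₂ (refl , eq)
path-contact {π} {π′} {p} {q} {p′} {q′} 0<k (northward eq)
  with north-south-match p q′ (G-positive 0<k)
... | refl , refl = inj₂ (refl , trans (sym (+ᴾ-inverseʳ π up)) (cong (_+ᴾ (-ᴾ up)) (sym eq)))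
path-contact {π} {π′} {p} {q} {p′} {q′} 0<k (southward eq)
  with north-south-match p′ q (G-positive 0<k)
... | refl , refl = inj₁ (refl , trans (sym (+ᴾ-inverseʳ π′ up)) (cong (_+ᴾ (-ᴾ up)) (sym eq)))

link-strength : ∀ π p q r → pairStrength G (π , pathTile p q) (π +ᴾ step (proj₁ q) , pathTile q r) ≡ 2
link-strength π p q@(vert , j) r =
  trans (contact-strength (southward {p = π} {q = π +ᴾ step vert} {t = pathTile p q} {u = pathTile q r} (sym (+ᴾ-inverseˡ π up)))) (G-line j)
link-strength π p q@(horiz , j) r =
  trans (contact-strength (eastward {p = π} {t = pathTile p q} {u = pathTile q r} refl)) (G-line j)

-- Supertiles that are translates of a path

_Is_ : ∀ {p q} → Config → Path p q → Set
X Is w = ∃[ o ] X ≐ place o w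

Is-shift : ∀ {p q} {w : Path p q} v {X} → X Is w → shift v X Is w
Is-shift {w = w} v {X} (o , X≐) = o +ᴾ v , subst (shift v X ≐_) (place-shift v o w) (≐-shift v X≐)

Is⇒≈ᵗ : ∀ {p q} {w : Path p q} {X Y} → X Is w → Y Is w → X ≈ᵗ Y
Is⇒≈ᵗ {w = w} {X} {Y} (o , X≐) (o′ , Y≐) = v , λ e →
    (λ e∈ → proj₂ (Y≐ e) (proj₁ (vX≐ e) e∈)) , (λ e∈ → proj₂ (vX≐ e) (proj₁ (Y≐ e) e∈))
  where
  v = o ⟶ o′
  vX≐ : shift v X ≐ place o′ w
  vX≐ = subst (λ Z → shift v X ≐ Z) (trans (place-shift v o w) (cong (λ o → place o w) (+ᴾ-⟶ o o′))) (≐-shift v X≐)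

≐-positions : ∀ {X Y} → X ≐ Y → ∀ {p} → p ∈ positions Y → p ∈ positions X
≐-positions X≐Y p∈ = let (t , t∈) = ∈-positions⁻ p∈ in ∈-positions⁺ (proj₂ (X≐Y (_ , t)) t∈)

≐-positions′ : ∀ {X Y} → X ≐ Y → ∀ {p} → p ∈ positions X → p ∈ positions Y
≐-positions′ X≐Y p∈ = let (t , t∈) = ∈-positions⁻ p∈ in ∈-positions⁺ (proj₁ (X≐Y (_ , t)) t∈)

≐-place-▸ : ∀ {p q r X Y o} {w : Path p q} {w′ : Path q r} →
            X ≐ place o w → Y ≐ place (exit o w) w′ → X ++ Y ≐ place o (w ▸ w′)
≐-place-▸ {X = X} {Y} {o} {w} {w′} X≐ Y≐ = subst (X ++ Y ≐_) (sym (place-▸ o w w′)) (≐-++ X≐ Y≐)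

-- A tile leaving towards a position outside its path must be the last one of the
-- path, and a tile entered from outside must be the first one.
path-follows : ∀ {p q p′ q′ X Y o o′ e f} {w : Path p q} {w′ : Path p′ q′} → Apart X Y →
               X ≐ place o w → Y ≐ place o′ w′ → e ∈ X → f ∈ Y →
               (E : Node o w e) (F : Node o′ w′ f) → Node.leave E ≡ Node.enter F →
               proj₁ f ≡ proj₁ e +ᴾ step (proj₁ (Node.leave E)) → q ≡ p′ × exit o w ≡ o′
path-follows {X = X} apart X≐ Y≐ e∈ f∈ (node _ (inj₁ (_ , u∈)) _) _ _ next =
  ⊥-elim (apart (subst (_∈ positions X) (sym next) (≐-positions X≐ (∈-positions⁺ u∈))) (∈-positions⁺ f∈))
path-follows {Y = Y} apart X≐ Y≐ e∈ f∈ _ (node _ _ (inj₂ (_ , π∈ , eq))) refl next =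
  ⊥-elim (apart (∈-positions⁺ e∈)
    (subst (_∈ positions Y) (sym (+ᴾ-cancelʳ _ (trans (sym next) eq))) (≐-positions Y≐ π∈)))
path-follows apart X≐ Y≐ e∈ f∈ (node _ (inj₂ (refl , eq)) _) (node _ _ (inj₁ (refl , eq′))) refl next =
  refl , trans (sym eq) (trans (sym next) eq′)

-- One positive contact decides: by `path-contact` one of its tiles leaves into the other, and
-- `path-follows` shows that this happens at the ends of the two paths.
attaches-path : ∀ {p q p′ q′ X Y} {w : Path p q} {w′ : Path p′ q′} (X≐ : X Is w) (Y≐ : Y Is w′) →
                Attaches X Y →
                (q ≡ p′ × exit (proj₁ X≐) w ≡ proj₁ Y≐) ⊎ (q′ ≡ p × exit (proj₁ Y≐) w′ ≡ proj₁ X≐)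
attaches-path {X = X} {Y} {w} {w′} (o , X≐) (o′ , Y≐) (disj , 2≤s)
  with strength-positive X Y (ℕₚ.≤-trans (s≤s z≤n) 2≤s)
... | e , f , k , e∈ , f∈ , 0<k , c
  with nodeAt o w (proj₁ (X≐ e) e∈) | nodeAt o′ w′ (proj₁ (Y≐ f) f∈)
... | E@(node refl _ _) | F@(node refl _ _) with path-contact 0<k c
...   | inj₁ (eq , eq′) = inj₁ (path-follows (disjoint⇒apart {X} {Y} disj) X≐ Y≐ e∈ f∈ E F eq eq′)
...   | inj₂ (eq , eq′) =
  inj₂ (path-follows (λ p∈Y p∈X → disjoint⇒apart {X} {Y} disj p∈X p∈Y) Y≐ X≐ f∈ e∈ F E eq eq′)

-- The rank of `exit o w` separates the two: `X` lies strictly below it, `Y` at or above it. The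
-- single link at the seam already has strength 2.
consecutive-attach : ∀ {p q r X Y o} {w : Path p q} {w′ : Path q r} →
                     X ≐ place o w → Y ≐ place (exit o w) w′ → Attaches X Y
consecutive-attach {q = q} {X = X} {Y} {o} {w} {w′} X≐ Y≐ =
    apart⇒disjoint {X} {Y} (λ p∈X p∈Y →
      ℤₚ.<⇒≱ (rank<exit o w (≐-positions′ X≐ p∈X)) (entry≤rank _ w′ (≐-positions′ Y≐ p∈Y)))
  , linked
  where
  linked : 2 ≤ strength G X Y
  linked with place-last o w | place-head (exit o w) w′
  ... | π , s , eq , π∈ | s′ , f∈ rewrite eq =
    subst (_≤ strength G X Y) (link-strength π s q s′)
      (pairStrength≤strength (proj₂ (X≐ _) π∈) (proj₂ (Y≐ _) f∈))

Is-▸-combine : ∀ {p q r X Y} {w : Path p q} {w′ : Path q r} → X Is w → Y Is w′ →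
               ∃[ v ] (CombinesAt G 2 X Y v × (X ++ shift v Y) Is (w ▸ w′))
Is-▸-combine {X = X} {Y} {w} {w′} (o , X≐) (o′ , Y≐) =
  v , consecutive-attach {w = w} {w′} X≐ vY≐ , o , ≐-place-▸ {w = w} {w′} X≐ vY≐
  where
  v = o′ ⟶ exit o w
  vY≐ : shift v Y ≐ place (exit o w) w′
  vY≐ = subst (λ Z → shift v Y ≐ Z) (trans (place-shift v o′ w′) (cong (λ o → place o w′) (+ᴾ-⟶ o′ _))) (≐-shift v Y≐)

-- `CanCombine` translates only its second argument, so here the earlier path is moved until it ends
-- where the later one starts.
Is-▸-combine′ : ∀ {p q r X Y} {w : Path p q} {w′ : Path q r} → X Is w → Y Is w′ → CanCombine G 2 Y X
Is-▸-combine′ {X = X} {Y} {w} {w′} (o , X≐) (o′ , Y≐) =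
  v , Attaches-sym {shift v X} {Y} (consecutive-attach {w = w} {w′} vX≐ (subst (λ o → Y ≐ place o w′) (sym exit≡) Y≐))
  where
  v = exit o w ⟶ o′
  exit-shift : ∀ o {p q} (w : Path p q) → exit (o +ᴾ v) w ≡ exit o w +ᴾ v
  exit-shift o (edge p q)    = +ᴾ-swap o v _
  exit-shift o (_◂_ p {q} w) = trans (cong (λ o → exit o w) (+ᴾ-swap o v _)) (exit-shift _ w)
  exit≡ : exit (o +ᴾ v) w ≡ o′
  exit≡ = trans (exit-shift o w) (+ᴾ-⟶ (exit o w) o′)
  vX≐ : shift v X ≐ place (o +ᴾ v) w
  vX≐ = subst (λ Z → shift v X ≐ Z) (place-shift v o w) (≐-shift v X≐)

-- Bins that assemble paths

-- Existence supplies the next stage with an actual supertile; the second half gives uniqueness of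
-- the terminal supertile.
Yields : ∀ {p q} → (Config → Set) → Path p q → Set
Yields Init w = ∃ (TerminalIn Init) × (∀ X → TerminalIn Init X → X Is w)

-- Copies of `w` could bind only exit to entry, which distinct end ports forbid.
carry : ∀ {Init p q} (w : Path p q) → p ≢ q → ∃ Init → (∀ {X} → Init X → X Is w) → Yields Init w
carry {Init} {p} {q} w p≢q (X₀ , X₀∈) initial = (X₀ , init X₀∈ , λ Y Y∈ → inert (initial X₀∈) (produced Y∈))
                                              , λ X (X∈ , _) → produced X∈
  where
  inert : ∀ {X Y} → X Is w → Y Is w → ¬ CanCombine G 2 X Y
  inert {X} {Y} X≐ Y≐ (v , att) with attaches-path {w = w} {w} X≐ (Is-shift v Y≐) att
  ... | inj₁ (q≡p , _) = p≢q (sym q≡p)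
  ... | inj₂ (q≡p , _) = p≢q (sym q≡p)
  produced : ∀ {X} → Prod G 2 Init X → X Is w
  produced (init X∈)               = initial X∈
  produced (combine v X∈ Y∈ att) = ⊥-elim (inert (produced X∈) (produced Y∈) (v , att))

-- The first two inequalities keep each piece from binding to its own copies. The third keeps the
-- joined path from doing so, and keeps `w` from following `w′`. The only possible attachment is
-- therefore `w` followed by `w′`.
module Joining {Init : Config → Set} {p q r : Port} (w : Path p q) (w′ : Path q r) (p≢q : p ≢ q) (q≢r : q ≢ r) (p≢r : p ≢ r)
               (initial : ∀ {X} → Init X → X Is w ⊎ X Is w′)
               (first : ∃[ X ] (Init X × X Is w)) (second : ∃[ X ] (Init X × X Is w′)) where

  data Piece (X : Config) : Set where
    fst  : X Is w → Piece X
    snd  : X Is w′ → Piece X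
    both : X Is (w ▸ w′) → Piece X

  Piece-shift : ∀ v {X} → Piece X → Piece (shift v X)
  Piece-shift v (fst X≐)  = fst (Is-shift v X≐)
  Piece-shift v (snd X≐)  = snd (Is-shift v X≐)
  Piece-shift v (both X≐) = both (Is-shift v X≐)

  both-inert : ∀ {X Y} → X Is (w ▸ w′) → Piece Y → ¬ Attaches X Y
  both-inert X≐ (fst Y≐)  att with attaches-path {w = w ▸ w′} {w} X≐ Y≐ att
  ... | inj₁ (r≡p , _) = p≢r (sym r≡p)
  ... | inj₂ (q≡p , _) = p≢q (sym q≡p)
  both-inert X≐ (snd Y≐)  att with attaches-path {w = w ▸ w′} {w′} X≐ Y≐ att
  ... | inj₁ (r≡q , _) = q≢r (sym r≡q)
  ... | inj₂ (r≡p , _) = p≢r (sym r≡p)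
  both-inert X≐ (both Y≐) att with attaches-path {w = w ▸ w′} {w ▸ w′} X≐ Y≐ att
  ... | inj₁ (r≡p , _) = p≢r (sym r≡p)
  ... | inj₂ (r≡p , _) = p≢r (sym r≡p)

  fst-snd : ∀ {X Y} → X Is w → Y Is w′ → Attaches X Y → (X ++ Y) Is (w ▸ w′)
  fst-snd X≐ Y≐ att with attaches-path {w = w} {w′} X≐ Y≐ att
  fst-snd (o , X≐) (_ , Y≐) att | inj₁ (_ , refl) = o , ≐-place-▸ {w = w} {w′} X≐ Y≐
  fst-snd _ _ _ | inj₂ (r≡p , _) = contradiction (sym r≡p) p≢r

  Piece-++ : ∀ {X Y} → Piece X → Piece Y → Attaches X Y → Piece (X ++ Y)
  Piece-++ (both X≐) Y∈ att = ⊥-elim (both-inert X≐ Y∈ att)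
  Piece-++ {X} {Y} X∈ (both Y≐) att = ⊥-elim (both-inert Y≐ X∈ (Attaches-sym {X} {Y} att))
  Piece-++ (fst X≐) (snd Y≐) att = both (fst-snd X≐ Y≐ att)
  Piece-++ {X} {Y} (snd X≐) (fst Y≐) att =
    let (o , YX≐) = fst-snd Y≐ X≐ (Attaches-sym {X} {Y} att)
    in both (o , λ e → (λ e∈ → proj₁ (YX≐ e) (∈-++-swap X e∈)) , (λ e∈ → ∈-++-swap Y (proj₂ (YX≐ e) e∈)))
  Piece-++ (fst X≐) (fst Y≐) att with attaches-path {w = w} {w} X≐ Y≐ att
  ... | inj₁ (q≡p , _) = contradiction (sym q≡p) p≢q
  ... | inj₂ (q≡p , _) = contradiction (sym q≡p) p≢q
  Piece-++ (snd X≐) (snd Y≐) att with attaches-path {w = w′} {w′} X≐ Y≐ att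
  ... | inj₁ (r≡q , _) = contradiction (sym r≡q) q≢r
  ... | inj₂ (r≡q , _) = contradiction (sym r≡q) q≢r

  produced : ∀ {X} → Prod G 2 Init X → Piece X
  produced (init X∈) = [ fst , snd ]′ (initial X∈)
  produced (combine v X∈ Y∈ att) = Piece-++ (produced X∈) (Piece-shift v (produced Y∈)) att

  join : Yields Init (w ▸ w′)
  join = existence first second , λ X X∈ → terminal (produced (proj₁ X∈)) X∈
    where
    existence : ∃[ X ] (Init X × X Is w) → ∃[ X ] (Init X × X Is w′) → ∃ (TerminalIn Init)
    existence (_ , X∈ , X≐) (_ , Y∈ , Y≐) =
      let (v , att , XY≐) = Is-▸-combine {w = w} {w′} X≐ Y≐
      in _ , combine v (init X∈) (init Y∈) att
           , λ Z Z∈ (v , att) → both-inert XY≐ (Piece-shift v (produced Z∈)) att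
    -- A lone piece is never terminal: its partner stays available among the initial supertiles.
    terminal : ∀ {X} → Piece X → TerminalIn Init X → X Is (w ▸ w′)
    terminal (both X≐) _ = X≐
    terminal (fst X≐) (_ , stuck) =
      let (Y , Y∈ , Y≐)  = second
          (v , att , _) = Is-▸-combine {w = w} {w′} X≐ Y≐
      in ⊥-elim (stuck Y (init Y∈) (v , att))
    terminal (snd Y≐) (_ , stuck) =
      let (X , X∈ , X≐) = first
      in ⊥-elim (stuck X (init X∈) (Is-▸-combine′ {w = w} {w′} X≐ Y≐))

-- Filling an L-shaped frame

-- Coordinates relative to the corner `c` of the L: the column lies at `i = 0`, the row at `j = 0`.
cell : Pos → ℕ → ℕ → Pos
cell c i j = c +ᴾ (+ i , + j)

cell-right : ∀ c i j → cell c (suc i) j ≡ cell c i j +ᴾ right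
cell-right (a , b) i j = cong₂ _,_ (lemma a (+ i)) (sym (ℤₚ.+-identityʳ _))
  where
  lemma : ∀ a k → a ℤ.+ (1ℤ ℤ.+ k) ≡ a ℤ.+ k ℤ.+ 1ℤ
  lemma = solve-∀

cell-up : ∀ c i j → cell c i (suc j) ≡ cell c i j +ᴾ up
cell-up (a , b) i j = cong₂ _,_ (sym (ℤₚ.+-identityʳ _)) (lemma b (+ j))
  where
  lemma : ∀ a k → a ℤ.+ (1ℤ ℤ.+ k) ≡ a ℤ.+ k ℤ.+ 1ℤ
  lemma = solve-∀

cell-down : ∀ c i j → cell c i (suc j) +ᴾ step vert ≡ cell c i j
cell-down c i j = trans (cong (_+ᴾ step vert) (cell-up c i j)) (+ᴾ-inverseʳ (cell c i j) up)

cell-injective : ∀ c {i j i′ j′} → cell c i j ≡ cell c i′ j′ → i ≡ i′ × j ≡ j′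
cell-injective (a , b) eq =
    ℤₚ.+-injective (∙-cancelˡ a _ _ (cong proj₁ eq)) , ℤₚ.+-injective (∙-cancelˡ b _ _ (cong proj₂ eq))

cell-shift : ∀ c v i j → cell (c +ᴾ v) i j ≡ cell c i j +ᴾ v
cell-shift c v i j = +ᴾ-swap c v _

fillTile : Tile
fillTile = tile 4 4 4 4

cornerTile : Tile
cornerTile = pathTile (vert , zero) (horiz , zero)

-- The column is traversed downwards: its tiles occupy the heights from `size w` to 1 and it leaves
-- into the corner at height 0.
column-exit : ∀ c {j k} (w : Path j k) → exit (cell c 0 (size w)) (along vert w) ≡ cell c 0 0
column-exit c (edge _ _) = cell-down c 0 0
column-exit c (_ ◂ w)    = trans (cong (λ o → exit o (along vert w)) (cell-down c 0 (size w))) (column-exit c w)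

column-view : ∀ c {j k} (w : Path j k) {e} → e ∈ place (cell c 0 (size w)) (along vert w) →
              ∃[ i ] ∃[ a ] ∃[ b ] (i < size w × e ≡ (cell c 0 (suc i) , pathTile (vert , a) (vert , b)))
column-view c (edge _ _) (here refl) = 0 , _ , _ , s≤s z≤n , refl
column-view c (_ ◂ w)    (here refl) = size w , _ , _ , ℕₚ.≤-refl , refl
column-view c (_ ◂ w) {e} (there e∈)  =
  let (i , a , b , i< , eq) = column-view c w (subst (λ o → e ∈ place o (along vert w)) (cell-down c 0 (size w)) e∈)
  in i , a , b , ℕₚ.m<n⇒m<1+n i< , eq

column-occupied : ∀ c {j k} (w : Path j k) {i} → i < size w →
                  cell c 0 (suc i) ∈ positions (place (cell c 0 (size w)) (along vert w))
column-occupied c (edge _ _) (s≤s z≤n) = here refl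
column-occupied c (_ ◂ w) {i} (s≤s i≤) with ℕₚ.m≤n⇒m<n∨m≡n i≤
... | inj₂ refl = here refl
... | inj₁ i<   = there (subst (λ o → cell c 0 (suc i) ∈ positions (place o (along vert w))) (sym (cell-down c 0 (size w)))
                          (column-occupied c w i<))

row-exit : ∀ c k {i j} (u : Path i j) → exit (cell c k 0) (along horiz u) ≡ cell c (k + size u) 0
row-exit c k (edge _ _) rewrite ℕₚ.+-comm k 1 = sym (cell-right c k 0)
row-exit c k (_ ◂ u) rewrite ℕₚ.+-suc k (size u) =
  trans (cong (λ o → exit o (along horiz u)) (sym (cell-right c k 0))) (row-exit c (suc k) u)

row-view : ∀ c k {i j} (u : Path i j) {e} → e ∈ place (cell c k 0) (along horiz u) →
           ∃[ i ] ∃[ a ] ∃[ b ] (i < size u × e ≡ (cell c (k + i) 0 , pathTile (horiz , a) (horiz , b)))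
row-view c k (edge _ _) (here refl) = 0 , _ , _ , s≤s z≤n , cong (λ k → cell c k 0 , _) (sym (ℕₚ.+-identityʳ k))
row-view c k (_ ◂ u)    (here refl) = 0 , _ , _ , s≤s z≤n , cong (λ k → cell c k 0 , _) (sym (ℕₚ.+-identityʳ k))
row-view c k (_ ◂ u) {e} (there e∈)  =
  let (i , a , b , i< , eq) = row-view c (suc k) u (subst (λ o → e ∈ place o (along horiz u)) (sym (cell-right c k 0)) e∈)
  in suc i , a , b , s≤s i< , trans eq (cong (λ k → cell c k 0 , pathTile (horiz , a) (horiz , b)) (sym (ℕₚ.+-suc k i)))

row-occupied : ∀ c k {j l} (u : Path j l) {i} → i < size u →
               cell c (k + i) 0 ∈ positions (place (cell c k 0) (along horiz u))
row-occupied c k (edge _ _) {zero} _ rewrite ℕₚ.+-identityʳ k = here refl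
row-occupied c k (_ ◂ u)    {zero} _ rewrite ℕₚ.+-identityʳ k = here refl
row-occupied c k (edge _ _) {suc i} (s≤s ())
row-occupied c k (_ ◂ u) {suc i} (s≤s i<) rewrite ℕₚ.+-suc k i =
  there (subst (λ o → cell c (suc (k + i)) 0 ∈ positions (place o (along horiz u))) (cell-right c k 0) (row-occupied c (suc k) u i<))

G-positiveʳ : ∀ x {y} → 0 < G x y → y ≢ null
G-positiveʳ x 0<G refl with () ← subst (0 <_) (trans (G-sym x null) (G-null x)) 0<G

shift-single : ∀ v t → shift v (single t) ≡ (v , t) ∷ []
shift-single (x , y) t = cong (λ p → (p , t) ∷ []) (cong₂ _,_ (ℤₚ.+-identityˡ x) (ℤₚ.+-identityˡ y))

fill-weak : ∀ e z → pairStrength G e (z , fillTile) ≤ 1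
fill-weak e z with contact e (z , fillTile)
... | inj₁ eq = subst (_≤ 1) (sym eq) z≤n
... | inj₂ (k , eq , c) = subst (_≤ 1) (sym eq) (weak c)
  where
  weak : ∀ {e z k} → Contact e (z , fillTile) k → k ≤ 1
  weak (eastward {t = t} _)  = G-weak (east t)
  weak (westward {t = t} _)  = subst (_≤ 1) (G-sym (west t) 4) (G-weak (west t))
  weak (northward {t = t} _) = G-weak (north t)
  weak (southward {t = t} _) = subst (_≤ 1) (G-sym (south t) 4) (G-weak (south t))

module Filling {x y : Fin 3} (w : Path x zero) (u : Path zero y) (size≡ : size u ≡ size w) where

  m : ℕ
  m = size w

  stem : Path (vert , x) (horiz , zero)
  stem = along vert w ▸ edge (vert , zero) (horiz , zero)

  frame : Path (vert , x) (horiz , y)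
  frame = stem ▸ along horiz u

  frameAt : Pos → Config
  frameAt c = place (cell c 0 m) frame

  private
    columnAt cornerAt rowAt : Pos → Config
    columnAt c = place (cell c 0 m) (along vert w)
    cornerAt c = (cell c 0 0 , cornerTile) ∷ []
    rowAt c    = place (cell c 1 0) (along horiz u)

  stem-exit : ∀ c → exit (cell c 0 m) stem ≡ cell c 1 0
  stem-exit c = begin
    exit (cell c 0 m) stem                     ≡⟨ exit-▸ (cell c 0 m) (along vert w) (edge (vert , zero) (horiz , zero)) ⟩
    exit (cell c 0 m) (along vert w) +ᴾ right  ≡⟨ cong (_+ᴾ right) (column-exit c w) ⟩
    cell c 0 0 +ᴾ right                        ≡⟨ cell-right c 0 0 ⟨
    cell c 1 0                                 ∎
    where open ≡-Reasoning

  frame-exit : ∀ c → exit (cell c 0 m) frame ≡ cell c (suc m) 0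
  frame-exit c = begin
    exit (cell c 0 m) frame                        ≡⟨ exit-▸ (cell c 0 m) stem (along horiz u) ⟩
    exit (exit (cell c 0 m) stem) (along horiz u)  ≡⟨ cong (λ o → exit o (along horiz u)) (stem-exit c) ⟩
    exit (cell c 1 0) (along horiz u)              ≡⟨ row-exit c 1 u ⟩
    cell c (suc (size u)) 0                        ≡⟨ cong (λ k → cell c (suc k) 0) size≡ ⟩
    cell c (suc m) 0                               ∎
    where open ≡-Reasoning

  frame-split : ∀ c → frameAt c ≡ (columnAt c ++ cornerAt c) ++ rowAt c
  frame-split c = begin
    frameAt c
      ≡⟨ place-▸ (cell c 0 m) stem (along horiz u) ⟩
    place (cell c 0 m) stem ++ place (exit (cell c 0 m) stem) (along horiz u)
      ≡⟨ cong₂ _++_ (place-▸ (cell c 0 m) (along vert w) corner) (cong (λ o → place o (along horiz u)) (stem-exit c)) ⟩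
    (columnAt c ++ place (exit (cell c 0 m) (along vert w)) corner) ++ rowAt c
      ≡⟨ cong (λ o → (columnAt c ++ place o corner) ++ rowAt c) (column-exit c w) ⟩
    (columnAt c ++ cornerAt c) ++ rowAt c ∎
    where
    open ≡-Reasoning
    corner = edge (vert , zero) (horiz , zero)

  frame-shift : ∀ v c → shift v (frameAt c) ≡ frameAt (c +ᴾ v)
  frame-shift v c = trans (place-shift v (cell c 0 m) frame) (cong (λ o → place o frame) (sym (cell-shift c v 0 m)))

  -- Partially filled squares and where a filling tile can attach

  data Site : ℕ → ℕ → Tile → Set where
    column   : ∀ {j a b} → j < m → Site 0 (suc j) (pathTile (vert , a) (vert , b))
    corner   : Site 0 0 cornerTile
    row      : ∀ {i a b} → i < m → Site (suc i) 0 (pathTile (horiz , a) (horiz , b))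
    interior : ∀ {i j} → i < m → j < m → Site (suc i) (suc j) fillTile

  site-bounds : ∀ {i j t} → Site i j t → i ≤ m × j ≤ m
  site-bounds (column j<)      = z≤n , j<
  site-bounds corner           = z≤n , z≤n
  site-bounds (row i<)         = i< , z≤n
  site-bounds (interior i< j<) = i< , j<

  frame-site : ∀ c {p t} → (p , t) ∈ frameAt c → ∃[ i ] ∃[ j ] (p ≡ cell c i j × Site i j t)
  frame-site c e∈ with ∈-++⁻ (columnAt c ++ cornerAt c) (subst (_ ∈_) (frame-split c) e∈)
  ... | inj₂ e∈row with row-view c 1 u e∈row
  ...   | i , _ , _ , i< , refl = suc i , 0 , refl , row (subst (i <_) size≡ i<)
  frame-site c e∈ | inj₁ e∈stem with ∈-++⁻ (columnAt c) e∈stem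
  ... | inj₂ (here refl) = 0 , 0 , refl , corner
  ... | inj₁ e∈col with column-view c w e∈col
  ...   | j , _ , _ , j< , refl = 0 , suc j , refl , column j<

  frame-left : ∀ c {j} → j ≤ m → cell c 0 j ∈ positions (frameAt c)
  frame-left c {j} j≤ = subst (λ X → cell c 0 j ∈ positions X) (sym (frame-split c))
    (let (_ , e∈) = ∈-positions⁻ (stem′ j≤) in ∈-positions⁺ (∈-++⁺ˡ e∈))
    where
    stem′ : ∀ {j} → j ≤ m → cell c 0 j ∈ positions (columnAt c ++ cornerAt c)
    stem′ {zero}  _  = ∈-positions⁺ (∈-++⁺ʳ (columnAt c) (here refl))
    stem′ {suc j} j< = let (_ , e∈) = ∈-positions⁻ (column-occupied c w j<) in ∈-positions⁺ (∈-++⁺ˡ e∈)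

  frame-bottom : ∀ c {i} → i ≤ m → cell c i 0 ∈ positions (frameAt c)
  frame-bottom c {zero}  _  = frame-left c z≤n
  frame-bottom c {suc i} i< = subst (λ X → cell c (suc i) 0 ∈ positions X) (sym (frame-split c))
    (let (_ , e∈) = ∈-positions⁻ (row-occupied c 1 u (subst (i <_) (sym size≡) i<))
     in ∈-positions⁺ (∈-++⁺ʳ (columnAt c ++ cornerAt c) e∈))

  frame-off-axes : ∀ c {i j} → cell c (suc i) (suc j) ∉ positions (frameAt c)
  frame-off-axes c p∈ with ∈-positions⁻ p∈
  ... | _ , e∈ with ∈-++⁻ (columnAt c ++ cornerAt c) (subst (_ ∈_) (frame-split c) e∈)
  ...   | inj₂ e∈row with row-view c 1 u e∈row
  ...     | _ , _ , _ , _ , eq with () ← proj₂ (cell-injective c (cong proj₁ eq))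
  frame-off-axes c p∈ | _ , e∈ | inj₁ e∈stem with ∈-++⁻ (columnAt c) e∈stem
  ... | inj₂ (here eq) with () ← proj₁ (cell-injective c (cong proj₁ eq))
  ... | inj₁ e∈col with column-view c w e∈col
  ...   | _ , _ , _ , _ , eq with () ← proj₁ (cell-injective c (cong proj₁ eq))

  Interior : Pos → Pos × Tile → Set
  Interior c e = ∃[ i ] ∃[ j ] (i < m × j < m × e ≡ (cell c (suc i) (suc j) , fillTile))

  -- The order of filling is not recorded. `down` confines the open boundary to the north and east;
  -- together with the null west and south sides of the L it gives `west-covered` and
  -- `south-covered`.
  record Partial (c : Pos) (X : Config) : Set where
    field
      origin : ∀ {e} → e ∈ X → e ∈ frameAt c ⊎ Interior c e
      frame⊆ : ∀ {e} → e ∈ frameAt c → e ∈ X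
      down   : ∀ {i j} → cell c (suc i) (suc j) ∈ positions X →
               cell c i (suc j) ∈ positions X × cell c (suc i) j ∈ positions X

    left : ∀ {j} → j ≤ m → cell c 0 j ∈ positions X
    left j≤ = let (_ , e∈) = ∈-positions⁻ (frame-left c j≤) in ∈-positions⁺ (frame⊆ e∈)

    bottom : ∀ {i} → i ≤ m → cell c i 0 ∈ positions X
    bottom i≤ = let (_ , e∈) = ∈-positions⁻ (frame-bottom c i≤) in ∈-positions⁺ (frame⊆ e∈)

    site : ∀ {p t} → (p , t) ∈ X → ∃[ i ] ∃[ j ] (p ≡ cell c i j × Site i j t)
    site e∈ with origin e∈
    ... | inj₁ e∈frame                 = frame-site c e∈frame
    ... | inj₂ (i , j , i< , j< , refl) = suc i , suc j , refl , interior i< j<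

    siteAt : ∀ {i j} → cell c i j ∈ positions X → ∃[ t ] ((cell c i j , t) ∈ X × Site i j t)
    siteAt p∈ with ∈-positions⁻ p∈
    ... | t , e∈ with site e∈
    ...   | _ , _ , eq , s with cell-injective c eq
    ...     | refl , refl = t , e∈ , s

    -- The column and the corner have a null west side; a row tile has the L to its west, an
    -- interior tile the cell given by `down`. This and `south-covered` leave no open glue to the
    -- west or south.
    west-covered : ∀ {p t} → (p , t) ∈ X → west t ≢ null → ∃[ q ] (q ∈ positions X × p ≡ q +ᴾ right)
    west-covered e∈ west≢ with site e∈
    ... | _ , _ , refl , column _ = contradiction refl west≢
    ... | _ , _ , refl , corner   = contradiction refl west≢
    ... | suc i , _ , refl , row i< = _ , bottom (ℕₚ.<⇒≤ i<) , cell-right c i 0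
    ... | suc i , j , refl , interior _ _ = _ , proj₁ (down (∈-positions⁺ e∈)) , cell-right c i j

    south-covered : ∀ {p t} → (p , t) ∈ X → south t ≢ null → ∃[ q ] (q ∈ positions X × p ≡ q +ᴾ up)
    south-covered e∈ south≢ with site e∈
    ... | _ , suc j , refl , column j< = _ , left (ℕₚ.<⇒≤ j<) , cell-up c 0 j
    ... | _ , _ , refl , corner = contradiction refl south≢
    ... | _ , _ , refl , row _  = contradiction refl south≢
    ... | i , suc j , refl , interior _ _ = _ , proj₂ (down (∈-positions⁺ e∈)) , cell-up c i j

  open Partial

  Partial-shift : ∀ v {c X} → Partial c X → Partial (c +ᴾ v) (shift v X)
  Partial-shift v {c} {X} P = record
    { origin = λ {e} → origin′ {e}
    ; frame⊆ = λ {e} → frame⊆′ {e}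
    ; down   = λ p∈ → let (a , b) = down P (unshift p∈) in toShift a , toShift b }
    where
    toShift : ∀ {i j} → cell c i j ∈ positions X → cell (c +ᴾ v) i j ∈ positions (shift v X)
    toShift {i} {j} p∈ = let (_ , e∈) = ∈-positions⁻ p∈ in
      subst (_∈ positions (shift v X)) (sym (cell-shift c v i j)) (∈-positions⁺ (∈-shift⁺ v e∈))
    unshift : ∀ {i j} → cell (c +ᴾ v) i j ∈ positions (shift v X) → cell c i j ∈ positions X
    unshift {i} {j} p∈ =
      let (_ , e∈)      = ∈-positions⁻ p∈
          (q , eq , q∈) = ∈-shift⁻ v e∈
      in subst (_∈ positions X) (+ᴾ-cancelʳ v (trans (sym eq) (cell-shift c v i j))) (∈-positions⁺ q∈)
    origin′ : ∀ {e} → e ∈ shift v X → e ∈ frameAt (c +ᴾ v) ⊎ Interior (c +ᴾ v) e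
    origin′ e∈ with ∈-shift⁻ v e∈
    ... | q , refl , q∈ with origin P q∈
    ...   | inj₁ q∈frame = inj₁ (subst (_ ∈_) (frame-shift v c) (∈-shift⁺ v q∈frame))
    ...   | inj₂ (i , j , i< , j< , refl) = inj₂ (i , j , i< , j< , cong (_, fillTile) (sym (cell-shift c v _ _)))
    frame⊆′ : ∀ {e} → e ∈ frameAt (c +ᴾ v) → e ∈ shift v X
    frame⊆′ e∈ with ∈-shift⁻ v (subst (_ ∈_) (sym (frame-shift v c)) e∈)
    ... | q , refl , q∈ = ∈-shift⁺ v (frame⊆ P q∈)

  -- Every contact uses a non-null west or south side of one partner. That side is already covered
  -- within its own supertile, so the other partner's tile would overlap it.
  partials-apart : ∀ {c c′ X Y} → Partial c X → Partial c′ Y → ¬ Attaches X Y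
  partials-apart {X = X} {Y} P Q (disj , 2≤s) with strength-positive X Y (ℕₚ.≤-trans (s≤s z≤n) 2≤s)
  ... | (p , t) , (q , u) , k , e∈ , f∈ , 0<k , c = exposed c 0<k e∈ f∈
    where
    apart = disjoint⇒apart {X} {Y} disj
    exposed : ∀ {p t q u k} → Contact (p , t) (q , u) k → 0 < k → (p , t) ∈ X → (q , u) ∈ Y → ⊥
    exposed (eastward {t = t} eq) 0<k e∈ f∈ = let (_ , r∈ , eq′) = west-covered Q f∈ (G-positiveʳ (east t) 0<k) in
      apart (∈-positions⁺ e∈) (subst (_∈ positions Y) (+ᴾ-cancelʳ right (trans (sym eq′) eq)) r∈)
    exposed (westward {u = u} eq) 0<k e∈ f∈ = let (_ , r∈ , eq′) = west-covered P e∈ (G-positiveʳ (east u) 0<k) in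
      apart (subst (_∈ positions X) (+ᴾ-cancelʳ right (trans (sym eq′) eq)) r∈) (∈-positions⁺ f∈)
    exposed (northward {t = t} eq) 0<k e∈ f∈ = let (_ , r∈ , eq′) = south-covered Q f∈ (G-positiveʳ (north t) 0<k) in
      apart (∈-positions⁺ e∈) (subst (_∈ positions Y) (+ᴾ-cancelʳ up (trans (sym eq′) eq)) r∈)
    exposed (southward {u = u} eq) 0<k e∈ f∈ = let (_ , r∈ , eq′) = south-covered P e∈ (G-positiveʳ (north u) 0<k) in
      apart (subst (_∈ positions X) (+ᴾ-cancelʳ up (trans (sym eq′) eq)) r∈) (∈-positions⁺ f∈)

  record Pocket (c : Pos) (X : Config) (z : Pos) : Set where
    constructor pocket
    field
      {i j} : ℕ
      i<m   : i < m
      j<m   : j < m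
      z≡    : z ≡ cell c (suc i) (suc j)
      west∈  : cell c i (suc j) ∈ positions X
      south∈ : cell c (suc i) j ∈ positions X

  -- Each contact of the filling tile is worth at most 1, so two positions of `X` contribute. A
  -- contributor to the east or north would have its west or south side uncovered. Two different
  -- contributors are thus the western and the southern neighbour.
  attaches⇒pocket : ∀ {c X z} → Partial c X → Unique (positions X) → Attaches X ((z , fillTile) ∷ []) → Pocket c X z
  attaches⇒pocket {c} {X} {z} P uX (disj , 2≤s)
    with two-contributors (λ e → pairStrength G e (z , fillTile)) (λ e → fill-weak e z) X uX
           (subst (2 ≤_) (strength-[-] X (z , fillTile)) 2≤s)
  ... | e , f , e∈ , f∈ , e≢f , 0<e , 0<f = corner-of (support e∈ 0<e) (support f∈ 0<f)
    where
    z∉ : z ∉ positions X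
    z∉ z∈ = disjoint⇒apart {X} {(z , fillTile) ∷ []} disj z∈ (here refl)

    Support : Pos × Tile → Set
    Support (p , t) = (z ≡ p +ᴾ right × east t ≡ 4) ⊎ (z ≡ p +ᴾ up × north t ≡ 4)

    support′ : ∀ {p t k} → (p , t) ∈ X → 0 < k → Contact (p , t) (z , fillTile) k → Support (p , t)
    support′ e∈ 0<k (eastward eq)  = inj₁ (eq , G-positive 0<k)
    support′ e∈ 0<k (westward eq)  = let (_ , r∈ , eq′) = west-covered P e∈ (G-positiveʳ 4 0<k) in
      ⊥-elim (z∉ (subst (_∈ positions X) (+ᴾ-cancelʳ right (trans (sym eq′) eq)) r∈))
    support′ e∈ 0<k (northward eq) = inj₂ (eq , G-positive 0<k)
    support′ e∈ 0<k (southward eq) = let (_ , r∈ , eq′) = south-covered P e∈ (G-positiveʳ 4 0<k) in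
      ⊥-elim (z∉ (subst (_∈ positions X) (+ᴾ-cancelʳ up (trans (sym eq′) eq)) r∈))

    support : ∀ {e} → e ∈ X → 0 < pairStrength G e (z , fillTile) → Support e
    support {e} e∈ 0<e = let (k , 0<k , c) = positive-contact e _ 0<e in support′ e∈ 0<k c

    -- The western support bounds the height of the new cell and the southern support its column.
    -- Filling stays inside the square because row tiles have line glues to the east and column
    -- tiles to the north.
    east-weak : ∀ {i j t} → Site i j t → east t ≡ 4 → ∃[ j′ ] (j ≡ suc j′ × j′ < m)
    east-weak (column j<)     _  = _ , refl , j<
    east-weak (row {b = b} _) eq = contradiction eq (lineGlue≢4 {b})
    east-weak (interior _ j<) _  = _ , refl , j<

    north-weak : ∀ {i j t} → Site i j t → north t ≡ 4 → ∃[ i′ ] (i ≡ suc i′ × i′ < m)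
    north-weak (column {a = a} _) eq = contradiction eq (lineGlue≢4 {a})
    north-weak (row i<)        _  = _ , refl , i<
    north-weak (interior i< _) _  = _ , refl , i<

    meet : ∀ {p t q s} → (p , t) ∈ X → (q , s) ∈ X → z ≡ p +ᴾ right → east t ≡ 4 → z ≡ q +ᴾ up → north s ≡ 4 →
           Pocket c X z
    meet e∈ f∈ z≡p t4 z≡q s4 with site P e∈ | site P f∈
    ... | i , _ , refl , S | _ , j , refl , T with east-weak S t4 | north-weak T s4
    ...   | j′ , refl , j< | i′ , refl , i<
      with cell-injective c (trans (cell-right c i (suc j′)) (trans (sym z≡p) (trans z≡q (sym (cell-up c (suc i′) j)))))
    ...     | refl , refl =
      pocket i< j< (trans z≡p (sym (cell-right c i (suc j′)))) (∈-positions⁺ e∈) (∈-positions⁺ f∈)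

    corner-of : Support e → Support f → Pocket c X z
    corner-of (inj₁ (eq , _)) (inj₁ (eq′ , _)) = contradiction (+ᴾ-cancelʳ right (trans (sym eq) eq′)) e≢f
    corner-of (inj₂ (eq , _)) (inj₂ (eq′ , _)) = contradiction (+ᴾ-cancelʳ up (trans (sym eq) eq′)) e≢f
    corner-of (inj₁ (eq , t4)) (inj₂ (eq′ , s4)) = meet e∈ f∈ eq t4 eq′ s4
    corner-of (inj₂ (eq , t4)) (inj₁ (eq′ , s4)) = meet f∈ e∈ eq′ s4 eq t4

  pocket⇒attaches : ∀ {c X z} → Partial c X → Pocket c X z → z ∉ positions X → Attaches X ((z , fillTile) ∷ [])
  pocket⇒attaches {c} {X} P (pocket {i} {j} i<m j<m refl west∈ south∈) z∉
    with siteAt P west∈ | siteAt P south∈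
  ... | t , e∈ , S | s , f∈ , T =
      apart⇒disjoint {X} {(z , fillTile) ∷ []} (λ { p∈ (here refl) → z∉ p∈ })
    , subst (2 ≤_) (sym (strength-[-] X (z , fillTile)))
        (distinct⇒2≤sum (λ e → pairStrength G e (z , fillTile)) e∈ f∈
          (λ eq → ℕₚ.1+n≢n (sym (proj₁ (cell-injective c (cong proj₁ eq)))))
          (subst (0 <_) (sym (trans (contact-strength (eastward {t = t} {fillTile} (cell-right c i (suc j)))) (east-weak S))) (s≤s z≤n))
          (subst (0 <_) (sym (trans (contact-strength (northward {t = s} {fillTile} (cell-up c (suc i) j))) (north-weak T))) (s≤s z≤n)))
    where
    z = cell c (suc i) (suc j)
    east-weak : ∀ {i j t} → Site i (suc j) t → G (east t) 4 ≡ 1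
    east-weak (column _)     = refl
    east-weak (interior _ _) = refl
    north-weak : ∀ {i j t} → Site (suc i) j t → G (north t) 4 ≡ 1
    north-weak (row _)        = refl
    north-weak (interior _ _) = refl

  Partial-grow : ∀ {c X z} → Partial c X → Pocket c X z → Partial c (X ++ (z , fillTile) ∷ [])
  Partial-grow {c} {X} P (pocket {i} {j} i<m j<m refl west∈ south∈) = record
    { origin = λ e∈ → [ origin P , (λ { (here refl) → inj₂ (i , j , i<m , j<m , refl) }) ]′ (∈-++⁻ X e∈)
    ; frame⊆ = λ e∈ → ∈-++⁺ˡ (frame⊆ P e∈)
    ; down   = down′ }
    where
    keep : ∀ {p} → p ∈ positions X → p ∈ positions (X ++ _)
    keep p∈ = let (_ , e∈) = ∈-positions⁻ p∈ in ∈-positions⁺ (∈-++⁺ˡ e∈)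
    down′ : ∀ {k l} → cell c (suc k) (suc l) ∈ positions (X ++ _) →
            cell c k (suc l) ∈ positions (X ++ _) × cell c (suc k) l ∈ positions (X ++ _)
    down′ p∈ with ∈-positions⁻ p∈
    ... | t , e∈ with ∈-++⁻ X e∈
    ...   | inj₁ e∈X = let (a , b) = down P (∈-positions⁺ e∈X) in keep a , keep b
    ...   | inj₂ (here eq) with cell-injective c (cong proj₁ eq)
    ...     | refl , refl = keep west∈ , keep south∈

  ≐-Partial : ∀ {c X Y} → X ≐ Y → Partial c X → Partial c Y
  ≐-Partial X≐ P = record
    { origin = λ {e} e∈ → origin P (proj₂ (X≐ e) e∈)
    ; frame⊆ = λ {e} e∈ → proj₁ (X≐ e) (frame⊆ P e∈)
    ; down   = λ p∈ → let (a , b) = down P (≐-positions X≐ p∈) in ≐-positions′ X≐ a , ≐-positions′ X≐ b }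

  centre : ∀ {X} → X Is frame → ∃[ c ] X ≐ frameAt c
  centre {X} (o , X≐) = o +ᴾ (-ᴾ (+ 0 , + m)) , subst (λ o → X ≐ place o frame) (sym (+ᴾ-inverseˡ o _)) X≐

  frame-Partial : ∀ {c X} → X ≐ frameAt c → Partial c X
  frame-Partial {c} X≐ = record
    { origin = λ {e} e∈ → inj₁ (proj₁ (X≐ e) e∈)
    ; frame⊆ = λ {e} e∈ → proj₂ (X≐ e) e∈
    ; down   = λ p∈ → ⊥-elim (frame-off-axes c (≐-positions′ X≐ p∈)) }

  record Complete (c : Pos) (X : Config) : Set where
    field
      partly : Partial c X
      unique : Unique (positions X)
      filled : ∀ {i j} → i < m → j < m → cell c (suc i) (suc j) ∈ positions X

    occupied : ∀ {i j} → i ≤ m → j ≤ m → cell c i j ∈ positions X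
    occupied {zero}         _  j≤ = left partly j≤
    occupied {suc i} {zero} i≤ _  = bottom partly i≤
    occupied {suc i} {suc j} i< j< = filled i< j<

  -- The filling bin: its terminal supertiles exist and are complete

  module Bin {Init : Config → Set} (m>0 : 0 < m)
             (initial-unique : ∀ {X} → Init X → Unique (positions X))
             (initial : ∀ {X} → Init X → X Is frame ⊎ X ≡ single fillTile)
             (filler : Init (single fillTile)) (seed : ∃[ X ] (Init X × X Is frame)) where

    data Stage (X : Config) : Set where
      growing : ∀ c → Partial c X → Stage X
      loose   : ∀ z → X ≡ (z , fillTile) ∷ [] → Stage X

    Stage-shift : ∀ v {X} → Stage X → Stage (shift v X)
    Stage-shift v (growing c P)  = growing (c +ᴾ v) (Partial-shift v P)
    Stage-shift v (loose z refl) = loose (z +ᴾ v) refl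

    Stage-++ : ∀ {X Y} → Unique (positions X) → Unique (positions Y) → Stage X → Stage Y → Attaches X Y → Stage (X ++ Y)
    Stage-++ uX uY (growing c P) (growing c′ Q) att = ⊥-elim (partials-apart P Q att)
    Stage-++ uX uY (growing c P) (loose z refl) att = growing c (Partial-grow P (attaches⇒pocket P uX att))
    Stage-++ {X} {Y} uX uY (loose z refl) (growing c P) att =
      growing c (≐-Partial (λ e → ∈-++-swap Y , ∈-++-swap X)
                  (Partial-grow P (attaches⇒pocket P uY (Attaches-sym {X} {Y} att))))
    -- Two filling tiles alone reach strength at most 1, below the temperature.
    Stage-++ uX uY (loose z refl) (loose z′ refl) (_ , 2≤s) =
      contradiction (ℕₚ.≤-trans (subst (2 ≤_) (trans (strength-[-] ((z , fillTile) ∷ []) (z′ , fillTile)) (ℕₚ.+-identityʳ _)) 2≤s)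
                              (fill-weak (z , fillTile) z′))
                    (λ { (s≤s ()) })

    produced-unique : ∀ {X} → Prod G 2 Init X → Unique (positions X)
    produced-unique = Prod-unique initial-unique

    shift-unique : ∀ v {X} → Unique (positions X) → Unique (positions (shift v X))
    shift-unique v {X} uX = subst Unique (sym (positions-shift v X)) (Unique.map⁺ (+ᴾ-cancelʳ v) uX)

    produced : ∀ {X} → Prod G 2 Init X → Stage X
    produced (init X∈) with initial X∈
    ... | inj₁ X≐   = let (c , X≐′) = centre X≐ in growing c (frame-Partial X≐′)
    ... | inj₂ refl = loose _ refl
    produced (combine v X∈ Y∈ att) =
      Stage-++ (produced-unique X∈) (shift-unique v (produced-unique Y∈)) (produced X∈) (Stage-shift v (produced Y∈)) att

    fill-at : ∀ {c X z} → Partial c X → Pocket c X z → z ∉ positions X → CombinesAt G 2 X (single fillTile) z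
    fill-at {X = X} {z} P k z∉ = subst (Attaches X) (sym (shift-single z fillTile)) (pocket⇒attaches P k z∉)

    -- Another partial square is excluded by `partials-apart`, and a filling tile would need a
    -- pocket, whose cell is already occupied.
    complete-terminal : ∀ {c X} → Prod G 2 Init X → Complete c X → TerminalIn Init X
    complete-terminal {c} {X} X∈ C = X∈ , λ Y Y∈ (v , att) → stuck (Stage-shift v (produced Y∈)) att
      where
      open Complete C
      stuck : ∀ {Y} → Stage Y → ¬ Attaches X Y
      stuck (growing _ Q)  att = partials-apart partly Q att
      stuck (loose z refl) att with attaches⇒pocket partly unique att
      ... | pocket i< j< refl _ _ = disjoint⇒apart {X} {(z , fillTile) ∷ []} (proj₁ att) (filled i< j<) (here refl)

    terminal-complete : ∀ {X} → TerminalIn Init X → ∃[ c ] Complete c X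
    terminal-complete {X} (X∈ , stuck) with produced X∈
    ... | growing c P = c , record { partly = P ; unique = produced-unique X∈ ; filled = filled _ _ }
      where
      filled : ∀ i j → i < m → j < m → cell c (suc i) (suc j) ∈ positions X
      west∈  : ∀ i j → i < m → j < m → cell c i (suc j) ∈ positions X
      south∈ : ∀ i j → i < m → j < m → cell c (suc i) j ∈ positions X
      -- Mutual recursion towards the axes: once the western and southern neighbours are known to be
      -- occupied, an empty cell would be a pocket, and `X` would not be terminal.
      filled i j i< j< with cell c (suc i) (suc j) ∈? positions X
      ... | yes p∈ = p∈
      ... | no p∉ = ⊥-elim (stuck _ (init filler)
                      (cell c (suc i) (suc j) , fill-at P (pocket i< j< refl (west∈ i j i< j<) (south∈ i j i< j<)) p∉))
      west∈ zero    j _  j< = left P j<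
      west∈ (suc i) j i< j< = filled i j (ℕₚ.<⇒≤ i<) j<
      south∈ i zero    i< _  = bottom P i<
      south∈ i (suc j) i< j< = filled i j i< (ℕₚ.<⇒≤ j<)
    -- A single filling tile is not terminal. Since `m` is positive, a bare frame has a pocket at
    -- cell (1 , 1); the frame is translated so that this cell falls on `z`.
    ... | loose z refl =
      let (Y , Y∈ , Y≐) = seed
          (c , Y≐c)     = centre Y≐
          v             = cell c 1 1 ⟶ z
          vY≐           = subst (shift v Y ≐_) (frame-shift v c) (≐-shift v Y≐c)
          P             = frame-Partial {c +ᴾ v} vY≐
          z≡            = sym (trans (cell-shift c v 1 1) (+ᴾ-⟶ (cell c 1 1) z))
          z∉            = λ z∈ → frame-off-axes (c +ᴾ v)
                            (subst (_∈ positions (frameAt (c +ᴾ v))) z≡ (≐-positions′ vY≐ z∈))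
      in ⊥-elim (stuck Y (init Y∈) (v ,
           Attaches-sym {shift v Y} (pocket⇒attaches P (pocket m>0 m>0 z≡ (left P m>0) (bottom P m>0)) z∉)))

    module _ {c : Pos} where

      RowsBelow : ℕ → Config → Set
      RowsBelow l X = ∀ {i j} → i < m → j < l → cell c (suc i) (suc j) ∈ positions X

      RowUpTo : ℕ → ℕ → Config → Set
      RowUpTo l k X = ∀ {i} → i < k → cell c (suc i) (suc l) ∈ positions X

      Grown : (Config → Set) → Set
      Grown Q = ∃[ X ] (Prod G 2 Init X × Partial c X × Q X)

      -- Row by row and from west to east, each next cell already has both supports. The cell is
      -- tested rather than assumed empty, because `RowUpTo` bounds the filled part only from below.
      fill-cell : ∀ {k l} → k < m → l < m → Grown (λ X → RowsBelow l X × RowUpTo l k X) →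
                  Grown (λ X → RowsBelow l X × RowUpTo l (suc k) X)
      fill-cell {k} {l} k< l< (X , X∈ , P , rows , done) with cell c (suc k) (suc l) ∈? positions X
      ... | yes z∈ = X , X∈ , P , rows , λ i< → upTo i<
        where
        upTo : RowUpTo l (suc k) X
        upTo (s≤s i≤) with ℕₚ.m≤n⇒m<n∨m≡n i≤
        ... | inj₁ i<   = done i<
        ... | inj₂ refl = z∈
      ... | no z∉ = X ++ shift z (single fillTile) , combine z X∈ (init filler) (fill-at P hole z∉)
                  , subst (λ Y → Partial c (X ++ Y)) (sym (shift-single z fillTile)) (Partial-grow P hole)
                  , (λ i< j< → keep (rows i< j<)) , upTo
        where
        z = cell c (suc k) (suc l)
        west∈ : ∀ {k} → RowUpTo l k X → cell c k (suc l) ∈ positions X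
        west∈ {zero}  _   = left P l<
        west∈ {suc k} done = done ℕₚ.≤-refl
        south∈ : ∀ {l} → RowsBelow l X → cell c (suc k) l ∈ positions X
        south∈ {zero}  _    = bottom P k<
        south∈ {suc l} rows = rows k< ℕₚ.≤-refl
        hole : Pocket c X z
        hole = pocket k< l< refl (west∈ done) (south∈ rows)
        keep : ∀ {p} → p ∈ positions X → p ∈ positions (X ++ shift z (single fillTile))
        keep p∈ = let (_ , e∈) = ∈-positions⁻ p∈ in ∈-positions⁺ (∈-++⁺ˡ e∈)
        upTo : RowUpTo l (suc k) (X ++ shift z (single fillTile))
        upTo (s≤s i≤) with ℕₚ.m≤n⇒m<n∨m≡n i≤
        ... | inj₁ i<   = keep (done i<)
        ... | inj₂ refl = ∈-positions⁺ (∈-++⁺ʳ X (subst ((z , fillTile) ∈_) (sym (shift-single z fillTile)) (here refl)))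

      fill-row : ∀ {l} k → k ≤ m → l < m → Grown (RowsBelow l) → Grown (λ X → RowsBelow l X × RowUpTo l k X)
      fill-row zero    _  l< (X , X∈ , P , rows) = X , X∈ , P , rows , λ ()
      fill-row (suc k) k< l< grown = fill-cell k< l< (fill-row k (ℕₚ.<⇒≤ k<) l< grown)

      fill-rows : ∀ l → l ≤ m → Grown (λ _ → ⊤) → Grown (RowsBelow l)
      fill-rows zero    _  (X , X∈ , P , _) = X , X∈ , P , λ _ ()
      fill-rows (suc l) l< grown with fill-row m ℕₚ.≤-refl l< (fill-rows l (ℕₚ.<⇒≤ l<) grown)
      ... | X , X∈ , P , rows , done = X , X∈ , P , below
        where
        below : RowsBelow (suc l) X
        below i< (s≤s j≤) with ℕₚ.m≤n⇒m<n∨m≡n j≤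
        ... | inj₁ j<   = rows i< j<
        ... | inj₂ refl = done i<

    terminal-exists : ∃ (TerminalIn Init)
    terminal-exists =
      let (Y , Y∈ , Y≐)       = seed
          (c , Y≐c)           = centre Y≐
          (X , X∈ , P , rows) = fill-rows {c} m ℕₚ.≤-refl (Y , init Y∈ , frame-Partial Y≐c , tt)
      in X , complete-terminal X∈ (record { partly = P ; unique = produced-unique X∈ ; filled = rows })

  -- Completed squares: shape, full connectedness, uniqueness up to translation

  module _ {c X} (C : Complete c X) where
    open Complete C

    complete-square : IsSquare (suc m) X
    complete-square = -ᴾ c , λ x y → inside , covered
      where
      recentre : ∀ i j → cell c i j +ᴾ (-ᴾ c) ≡ (+ i , + j)
      recentre i j = trans (cong (_+ᴾ (-ᴾ c)) (+ᴾ-comm c (+ i , + j))) (+ᴾ-inverseʳ (+ i , + j) c)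
      inside : ∀ {x y} → (x , y) ∈ positions (shift (-ᴾ c) X) →
               (0ℤ ℤ.≤ x × x ℤ.< + suc m) × (0ℤ ℤ.≤ y × y ℤ.< + suc m)
      inside p∈ with ∈-positions⁻ p∈
      ... | _ , e∈ with ∈-shift⁻ (-ᴾ c) e∈
      ...   | q , eq , q∈ with site partly q∈
      ...     | i , j , refl , s with trans eq (recentre i j) | site-bounds s
      ...       | refl | i≤ , j≤ = (ℤ.+≤+ z≤n , ℤ.+<+ (s≤s i≤)) , (ℤ.+≤+ z≤n , ℤ.+<+ (s≤s j≤))
      covered : ∀ {x y} → (0ℤ ℤ.≤ x × x ℤ.< + suc m) × (0ℤ ℤ.≤ y × y ℤ.< + suc m) →
                (x , y) ∈ positions (shift (-ᴾ c) X)
      covered {+ i} {+ j} ((_ , ℤ.+<+ (s≤s i≤)) , (_ , ℤ.+<+ (s≤s j≤))) =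
        let (_ , e∈) = ∈-positions⁻ (occupied i≤ j≤) in
        subst (_∈ positions (shift (-ᴾ c) X)) (recentre i j) (∈-positions⁺ (∈-shift⁺ (-ᴾ c) e∈))

    on-axis : ∀ {i j t} → (cell c i j , t) ∈ X → i ≡ 0 ⊎ j ≡ 0 → (cell c i j , t) ∈ frameAt c
    on-axis e∈ axis with origin partly e∈
    ... | inj₁ e∈frame = e∈frame
    ... | inj₂ (_ , _ , _ , _ , eq) with cell-injective c (cong proj₁ eq) | axis
    ...   | refl , _ | inj₁ ()
    ...   | _ , refl | inj₂ ()

    -- The frame ends by pointing to cell (m + 1 , 0), just outside the square. So its last tile has
    -- no neighbour there whose glue would have to match.
    exit∉ : ∀ {p} → p ∈ positions X → p ≢ exit (cell c 0 m) frame
    exit∉ p∈ eq with ∈-positions⁻ p∈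
    ... | _ , e∈ with site partly e∈
    ...   | _ , _ , refl , s with cell-injective c (trans eq (frame-exit c))
    ...     | refl , refl = ℕₚ.1+n≰n (proj₁ (site-bounds s))

    -- An east side that is not weak is where the path leaves the tile. The next path tile lies
    -- there, and uniqueness of positions identifies it with the given neighbour.
    east-linked : ∀ {p t s} → (p , t) ∈ frameAt c → (p +ᴾ right , s) ∈ X → east t ≢ 4 → 0 < G (east t) (west s)
    east-linked e∈ f∈ east≢ with nodeAt (cell c 0 m) frame e∈
    ... | node {leave = vert , _} refl _ _ = contradiction refl east≢
    ... | node {leave = horiz , _} refl (inj₂ (_ , eq)) _ = contradiction eq (exit∉ (∈-positions⁺ f∈))
    ... | node {leave = horiz , b} refl (inj₁ (_ , g∈)) _ with unique-tile unique f∈ (frame⊆ partly g∈)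
    ...   | refl = subst (0 <_) (sym (G-line b)) (s≤s z≤n)

    -- The path descends, so here it is the upper tile that leaves into the lower one.
    south-linked : ∀ {p t s} → (p , t) ∈ X → (p +ᴾ up , s) ∈ frameAt c → south s ≢ null → 0 < G (north t) (south s)
    south-linked {p} {t} e∈ f∈ south≢ with nodeAt (cell c 0 m) frame f∈
    ... | node {leave = horiz , _} refl _ _ = contradiction refl south≢
    ... | node {leave = vert , _} refl (inj₂ (_ , eq)) _ =
      contradiction (trans (sym (+ᴾ-inverseʳ p up)) eq) (exit∉ (∈-positions⁺ e∈))
    ... | node {leave = vert , b} refl (inj₁ (_ , g∈)) _
      with unique-tile unique e∈ (subst (λ p → (p , _) ∈ X) (+ᴾ-inverseʳ p up) (frame⊆ partly g∈))
    ...   | refl = subst (0 <_) (sym (G-line b)) (s≤s z≤n)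

    private
      east-glued : ∀ {p t s} → (p , t) ∈ X → (p +ᴾ right , s) ∈ X → 0 < G (east t) (west s)
      east-glued e∈ f∈ with site partly e∈ | site partly f∈
      ... | i , j , refl , S | _ , _ , eq , T with cell-injective c (trans (cell-right c i j) eq)
      ...   | refl , refl with S | T
      ...     | column _       | interior _ _ = s≤s z≤n
      ...     | interior _ _   | interior _ _ = s≤s z≤n
      ...     | corner         | row _ = east-linked (on-axis e∈ (inj₂ refl)) f∈ (λ ())
      ...     | row {b = b} _  | row _ = east-linked (on-axis e∈ (inj₂ refl)) f∈ (lineGlue≢4 {b})

      north-glued : ∀ {p t s} → (p , t) ∈ X → (p +ᴾ up , s) ∈ X → 0 < G (north t) (south s)
      north-glued e∈ f∈ with site partly e∈ | site partly f∈
      ... | i , j , refl , S | _ , _ , eq , T with cell-injective c (trans (cell-up c i j) eq)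
      ...   | refl , refl with S | T
      ...     | row _        | interior _ _ = s≤s z≤n
      ...     | interior _ _ | interior _ _ = s≤s z≤n
      ...     | corner       | column _ = south-linked e∈ (climb f∈) (λ ())
        where
        climb : ∀ {s} → (cell c 0 0 +ᴾ up , s) ∈ X → (cell c 0 0 +ᴾ up , s) ∈ frameAt c
        climb rewrite sym (cell-up c 0 0) = λ f∈ → on-axis f∈ (inj₁ refl)
      ...     | column {j} _ | column _ = south-linked e∈ (climb f∈) (λ ())
        where
        climb : ∀ {s} → (cell c 0 (suc j) +ᴾ up , s) ∈ X → (cell c 0 (suc j) +ᴾ up , s) ∈ frameAt c
        climb rewrite sym (cell-up c 0 (suc j)) = λ f∈ → on-axis f∈ (inj₁ refl)

    complete-connected : FullyConnected G X
    complete-connected {x} {y} {t} {s} e∈ =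
        (λ f∈ → east-glued e∈ (subst (λ y′ → ((x ℤ.+ 1ℤ , y′) , s) ∈ X) (sym (ℤₚ.+-identityʳ y)) f∈))
      , (λ f∈ → north-glued e∈ (subst (λ x′ → ((x′ , y ℤ.+ 1ℤ) , s) ∈ X) (sym (ℤₚ.+-identityʳ x)) f∈))

  -- The frame fixes all tiles on the axes, and every other cell holds `fillTile`. Applied in both
  -- directions this yields `complete-≈ᵗ`.
  complete-⊆ : ∀ {c c′ X Y} → Complete c X → Complete c′ Y → ∀ {p t} → (p , t) ∈ X → (p +ᴾ (c ⟶ c′) , t) ∈ Y
  complete-⊆ {c} {c′} {X} {Y} C D e∈ with origin (Complete.partly C) e∈
  ... | inj₁ e∈frame = frame⊆ (Complete.partly D)
    (subst (_ ∈_) (trans (frame-shift (c ⟶ c′) c) (cong frameAt (+ᴾ-⟶ c c′))) (∈-shift⁺ (c ⟶ c′) e∈frame))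
  ... | inj₂ (i , j , i< , j< , refl) with siteAt (Complete.partly D) (Complete.filled D i< j<)
  ...   | _ , f∈ , interior _ _ = subst (λ p → (p , fillTile) ∈ Y) (sym (⟶-+ᴾ c c′ _)) f∈

  complete-≈ᵗ : ∀ {c c′ X Y} → Complete c X → Complete c′ Y → X ≈ᵗ Y
  complete-≈ᵗ {c} {c′} {X} {Y} C D = c ⟶ c′ , λ e → forth , back
    where
    forth : ∀ {e} → e ∈ shift (c ⟶ c′) X → e ∈ Y
    forth e∈ with ∈-shift⁻ (c ⟶ c′) e∈
    ... | _ , refl , p∈ = complete-⊆ C D p∈
    return : ∀ q → (q +ᴾ (c′ ⟶ c)) +ᴾ (c ⟶ c′) ≡ q
    return q = trans (+ᴾ-assoc q (c′ ⟶ c) (c ⟶ c′)) (trans (cong (q +ᴾ_) cancel) (cong₂ _,_ (ℤₚ.+-identityʳ _) (ℤₚ.+-identityʳ _)))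
      where
      lemma : ∀ a b → (ℤ.- b ℤ.+ a) ℤ.+ (ℤ.- a ℤ.+ b) ≡ 0ℤ
      lemma = solve-∀
      cancel : (c′ ⟶ c) +ᴾ (c ⟶ c′) ≡ (0ℤ , 0ℤ)
      cancel = cong₂ _,_ (lemma (proj₁ c) (proj₁ c′)) (lemma (proj₂ c) (proj₂ c′))
    back : ∀ {e} → e ∈ Y → e ∈ shift (c ⟶ c′) X
    back {q , t} e∈ = subst (λ q → (q , t) ∈ shift (c ⟶ c′) X) (return q) (∈-shift⁺ (c ⟶ c′) (complete-⊆ D C e∈))

-- The staged system

-- Adding 1 modulo 3 for `true`, subtracting 1 for `false`.
next : Bool → Fin 3 → Fin 3
next true  zero             = suc zero
next true  (suc zero)       = suc (suc zero)
next true  (suc (suc zero)) = zero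
next false zero             = suc (suc zero)
next false (suc zero)       = zero
next false (suc (suc zero)) = suc zero

-- Modulo 3, two steps one way are one step the other way.
next-twice : ∀ o j → next o (next o j) ≡ next (not o) j
next-twice true  zero             = refl
next-twice true  (suc zero)       = refl
next-twice true  (suc (suc zero)) = refl
next-twice false zero             = refl
next-twice false (suc zero)       = refl
next-twice false (suc (suc zero)) = refl

j≢next : ∀ o j → j ≢ next o j
j≢next true  zero             ()
j≢next true  (suc zero)       ()
j≢next true  (suc (suc zero)) ()
j≢next false zero             ()
j≢next false (suc zero)       ()
j≢next false (suc (suc zero)) ()

j≢next² : ∀ o j → j ≢ next o (next o j)
j≢next² o j eq = j≢next (not o) j (trans eq (next-twice o j))

Bin : Set
Bin = Dir × Fin 3

encode : Bin → Fin 6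
encode (d , j) = Fin.combine d j

decode : Fin 6 → Bin
decode = Fin.remQuot {2} 3

decode-encode : ∀ β → decode (encode β) ≡ β
decode-encode (d , j) = Finₚ.remQuot-combine d j

encode-decode : ∀ b → encode (decode b) ≡ b
encode-decode = Finₚ.combine-remQuot {2} 3

data Op : Set where
  double increment : Op

run : ℕ → List Op → ℕ
run k []               = k
run k (double ∷ ops)    = run (k + k) ops
run k (increment ∷ ops) = run (k + 1) ops

-- In phase lines o ops, bin (d , j) holds a line in direction d from glue j to
-- glue next o j, and ops remains to be done.  Two consecutive lines compose to one
-- of the opposite orientation, since next o ∘ next o = next (not o).
data Phase : Set where
  lines : Bool → List Op → Phase
  cornered framed filled idle : Phase

advance : Phase → Phase
advance (lines o [])        = cornered
advance (lines o (_ ∷ ops)) = lines (not o) ops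
advance cornered            = framed
advance framed              = filled
advance filled              = idle
advance idle                = idle

-- What a bin receives in the stage that follows a given phase.
addedTiles : Phase → Bin → List Tile
addedTiles (lines o (increment ∷ _)) (d , j)   = pathTile (d , next o j) (d , next o (next o j)) ∷ []
addedTiles (lines o (double ∷ _)) _            = []
addedTiles (lines o [])           (vert , zero) = cornerTile ∷ []
addedTiles framed                 (vert , zero) = fillTile ∷ []
addedTiles _ _ = []

sources : Phase → Bin → List Bin
sources (lines o (increment ∷ _)) (d , j)     = (d , j) ∷ []
sources (lines o (double ∷ _)) (d , j)        = (d , j) ∷ (d , next o j) ∷ []
-- The column must end in glue `zero` to meet the corner tile, so it comes from the bin of the
-- cyclic predecessor of `zero` under `next o`.
sources (lines o [])           (vert , zero)  = (vert , next (not o) zero) ∷ []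
sources (lines o [])           (horiz , zero) = (horiz , zero) ∷ []
sources cornered               (vert , zero)  = (vert , zero) ∷ (horiz , zero) ∷ []
sources framed                 (vert , zero)  = (vert , zero) ∷ []
sources _ _ = []

lineTile : Dir × Bool → Fin 3 → Tile
lineTile (d , o) j = pathTile (d , j) (d , next o j)

startTile : Bin → Tile
startTile (d , j) = lineTile (d , true) j

-- Two directions, two orientations and three glues give twelve line tiles; with the two special
-- tiles this makes 14.
tileSet : List Tile
tileSet = fillTile ∷ cornerTile ∷
  cartesianProductWith lineTile (cartesianProduct (allFin 2) (true ∷ false ∷ [])) (allFin 3)

line∈tileSet : ∀ d o j → lineTile (d , o) j ∈ tileSet
line∈tileSet d o j = there (there (∈-cartesianProductWith⁺ lineTile (∈-cartesianProduct⁺ (∈-allFin d) (orientation o)) (∈-allFin j)))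
  where
  orientation : ∀ o → o ∈ true ∷ false ∷ []
  orientation true  = here refl
  orientation false = there (here refl)

added∈tileSet : ∀ s β {t} → t ∈ addedTiles s β → t ∈ tileSet
added∈tileSet (lines o (increment ∷ _)) (d , j) (here refl) = line∈tileSet d o (next o j)
added∈tileSet (lines o []) (vert , zero) (here refl) = there (here refl)
added∈tileSet framed       (vert , zero) (here refl) = here refl

tileSet-glues : All (λ t → All (λ g → g ≡ null ⊎ g ∈ 1 ∷ 2 ∷ 3 ∷ 4 ∷ []) (north t ∷ east t ∷ south t ∷ west t ∷ [])) tileSet
tileSet-glues = toWitness {a? = All.all? (λ t → All.all? (λ g → (g ℕ.≟ null) ⊎-dec (g ∈ᴳ? (1 ∷ 2 ∷ 3 ∷ 4 ∷ []))) _) tileSet} _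

-- Correctness of the staged system, stage by stage

module System (ops : List Op) where

  phase : ℕ → Phase
  phase zero    = lines true ops
  phase (suc i) = advance (phase i)

  tilesIn : ℕ → Fin 6 → List Tile
  tilesIn zero    b = startTile (decode b) ∷ []
  tilesIn (suc i) b = addedTiles (phase i) (decode b)

  system : StagedSystem
  system = record
    { τ = 2 ; τ-pos = s≤s z≤n
    ; G = G ; G-sym = G-sym ; G-null = G-null ; G-bound = G≤2
    ; stages = 4 + length ops ; stages-pos = s≤s z≤n
    ; bins = 6
    ; tilesIn = tilesIn
    ; mix = λ { zero _ _ → false ; (suc i) b k → does (decode k ∈ᴮ? sources (phase i) (decode b)) }
    -- Bin 0 is `encode (vert , zero)`, where the square is filled.
    ; output = λ b → does (b Finₚ.≟ zero) }

  tilesIn∈tileSet : ∀ i b {t} → t ∈ tilesIn i b → t ∈ tileSet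
  tilesIn∈tileSet zero    b (here refl) = line∈tileSet (proj₁ (decode b)) true (proj₂ (decode b))
  tilesIn∈tileSet (suc i) b t∈          = added∈tileSet (phase i) (decode b) t∈

  Contents : ℕ → Bin → Config → Set
  Contents i β = Initial system i (encode β)

  -- The phase comes with an equation so that `addedTiles` and `sources` compute on a concrete `s`.
  -- The encoding of bins as numbers is also dealt with here, once for all phases.
  initial⁻ : ∀ {i s β X} → phase i ≡ s → Contents (suc i) β X →
             (∃[ t ] (t ∈ addedTiles s β × X ≡ single t)) ⊎ (∃[ α ] (α ∈ sources s β × TerminalIn (Contents i α) X))
  initial⁻ {i} {β = β} refl (inj₁ (t , t∈ , X≡)) = inj₁ (t , subst (λ β → t ∈ addedTiles (phase i) β) (decode-encode β) t∈ , X≡)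
  initial⁻ {i} {β = β} {X} refl (inj₂ (k , mixed , T)) =
    inj₂ (decode k , subst (λ β → decode k ∈ sources (phase i) β) (decode-encode β) (witness (decode k ∈ᴮ? _) mixed)
                   , subst (λ k → Terminal system i k X) (sym (encode-decode k)) T)
    where
    witness : ∀ {P : Set} (P? : Dec P) → does P? ≡ true → P
    witness (yes p) _ = p

  initial⁺-tile : ∀ {i s β t} → phase i ≡ s → t ∈ addedTiles s β → Contents (suc i) β (single t)
  initial⁺-tile {i} {β = β} {t} refl t∈ =
    inj₁ (t , subst (λ β → t ∈ addedTiles (phase i) β) (sym (decode-encode β)) t∈ , refl)

  initial⁺-source : ∀ {i s α β X} → phase i ≡ s → α ∈ sources s β → TerminalIn (Contents i α) X → Contents (suc i) β X
  initial⁺-source {i} {α = α} {β} refl α∈ T =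
    inj₂ (encode α , dec-true (_ ∈ᴮ? _) (subst₂ (λ α β → α ∈ sources (phase i) β) (sym (decode-encode α)) (sym (decode-encode β)) α∈) , T)

  tile-initial : ∀ {i s β p q} → phase i ≡ s → pathTile p q ∈ addedTiles s β →
                 ∃[ X ] (Contents (suc i) β X × X Is edge p q)
  tile-initial {β = β} ph t∈ = _ , initial⁺-tile {β = β} ph t∈ , _ , λ e → id , id

  source-initial : ∀ {i s α β p q} {w : Path p q} → phase i ≡ s → α ∈ sources s β → Yields (Contents i α) w →
                   ∃[ X ] (Contents (suc i) β X × X Is w)
  source-initial {α = α} {β} ph α∈ ((X , T) , is) = X , initial⁺-source {α = α} {β} ph α∈ T , is X T

  UniqueBin : ℕ → Bin → Set
  UniqueBin i β = ∀ X Y → TerminalIn (Contents i β) X → TerminalIn (Contents i β) Y → X ≈ᵗ Y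

  yields-unique : ∀ {i p q} {w : Path p q} β → Yields (Contents i β) w → UniqueBin i β
  yields-unique {w = w} β (_ , is) X Y X∈ Y∈ = Is⇒≈ᵗ {w = w} (is X X∈) (is Y Y∈)

  empty-unique : ∀ {i s} β → phase i ≡ s → addedTiles s β ≡ [] → sources s β ≡ [] → UniqueBin (suc i) β
  empty-unique {i} {s} β ph tiles≡ sources≡ X Y (X∈ , _) _ = ⊥-elim (empty X∈)
    where
    empty : ∀ {X} → ¬ Prod G 2 (Contents (suc i) β) X
    empty (combine _ X∈ _ _) = empty X∈
    empty (init X∈) with initial⁻ {β = β} ph X∈
    ... | inj₁ (t , t∈ , _) with () ← subst (t ∈_) tiles≡ t∈
    ... | inj₂ (α , α∈ , _) with () ← subst (α ∈_) sources≡ α∈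

  -- While lines are built, all six have the same length `k`; this is what later makes the column
  -- and the row of the L equally long. In `cornered`, `zero ≢ y` is kept because joining stem and
  -- row needs distinct ports.
  Holds : ℕ → ℕ → Phase → Set
  Holds m i (lines o ops) = ∃[ k ] (run k ops ≡ m ×
    (∀ j → Σ[ w ∈ Path j (next o j) ] (size w ≡ k × (∀ d → Yields (Contents i (d , j)) (along d w)))))
  Holds m i cornered = ∃[ x ] ∃[ y ] Σ[ w ∈ Path x zero ] Σ[ u ∈ Path zero y ] (size w ≡ m × size u ≡ m × zero ≢ y ×
    Yields (Contents i (vert , zero)) (along vert w ▸ edge (vert , zero) (horiz , zero)) ×
    Yields (Contents i (horiz , zero)) (along horiz u))
  Holds m i framed = ∃[ x ] ∃[ y ] Σ[ w ∈ Path x zero ] Σ[ u ∈ Path zero y ] Σ[ size≡ ∈ size u ≡ size w ] (size w ≡ m ×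
    Yields (Contents i (vert , zero)) (Filling.frame w u size≡))
  Holds m i filled = ∃ (TerminalIn (Contents i (vert , zero))) ×
    (∀ X → TerminalIn (Contents i (vert , zero)) X → IsSquare (suc m) X × FullyConnected G X)
  Holds m i idle = ⊤

  Spec : ℕ → ℕ → Phase → Set
  Spec m i s = Holds m i s × (∀ β → UniqueBin i β)

  same-dir : ∀ {d : Dir} {j k : Fin 3} → j ≢ k → (d , j) ≢ (d , k)
  same-dir j≢k refl = j≢k refl

  start : Spec (run 1 ops) 0 (lines true ops)
  start = (1 , refl , λ j → edge j (next true j) , refl , λ d → yields d j) , λ (d , j) → yields-unique {w = edge (d , j) (d , next true j)} (d , j) (yields d j)
    where
    yields : ∀ d j → Yields (Contents 0 (d , j)) (edge (d , j) (d , next true j))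
    yields d j = carry (edge (d , j) (d , next true j)) (same-dir (j≢next true j))
      (_ , startTile (d , j) , subst (λ β → startTile (d , j) ∈ startTile β ∷ []) (sym (decode-encode (d , j))) (here refl) , refl)
      initial
      where
      initial : ∀ {X} → Contents 0 (d , j) X → X Is edge (d , j) (d , next true j)
      initial (_ , t∈ , refl) with subst (λ β → _ ∈ startTile β ∷ []) (decode-encode (d , j)) t∈
      ... | here refl = _ , λ e → id , id

  -- Common end of both operations: a doubled line and a line with one tile appended each advance by
  -- two glues, so either way the orientation flips.
  compose : ∀ {m i} o {ops k} →
            (∀ j → Σ[ w ∈ Path j (next o (next o j)) ] (size w ≡ k × (∀ d → Yields (Contents i (d , j)) (along d w)))) →
            run k ops ≡ m → Spec m i (lines (not o) ops)
  compose {i = i} o {k = k} made eq =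
      (k , eq , λ j → subst (λ l → Σ[ w ∈ Path j l ] (size w ≡ k × (∀ d → Yields (Contents i (d , j)) (along d w))))
                            (next-twice o j) (made j))
    , λ (d , j) → let (w , _ , yields) = made j in yields-unique {w = along d w} (d , j) (yields d)

  advance-spec : ∀ {m} i s → phase i ≡ s → Spec m i s → Spec m (suc i) (advance s)
  advance-spec {m} i s@(lines o (double ∷ ops)) ph ((k , eq , line) , _) = compose o {ops} made eq
    where
    made : ∀ j → Σ[ w ∈ Path j (next o (next o j)) ] (size w ≡ k + k × (∀ d → Yields (Contents (suc i) (d , j)) (along d w)))
    made j with line j | line (next o j)
    ... | w , size≡ , Y | w′ , size′≡ , Y′ =
      w ▸ w′ , trans (size-▸ w w′) (cong₂ _+_ size≡ size′≡) , λ d →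
        subst (Yields _) (sym (along-▸ d w w′))
          (Joining.join (along d w) (along d w′)
            (same-dir (j≢next o j)) (same-dir (j≢next o (next o j))) (same-dir (j≢next² o j))
            (initial d)
            (source-initial {α = d , j} {d , j} ph (here refl) (Y d))
            (source-initial {α = d , next o j} {d , j} ph (there (here refl)) (Y′ d)))
      where
      initial : ∀ d {X} → Contents (suc i) (d , j) X → X Is along d w ⊎ X Is along d w′
      initial d {X} X∈ with initial⁻ {β = d , j} ph X∈
      ... | inj₂ (_ , here refl , T)         = inj₁ (proj₂ (Y d) X T)
      ... | inj₂ (_ , there (here refl) , T) = inj₂ (proj₂ (Y′ d) X T)
  advance-spec {m} i s@(lines o (increment ∷ ops)) ph ((k , eq , line) , _) = compose o {ops} made eq
    where
    made : ∀ j → Σ[ w ∈ Path j (next o (next o j)) ] (size w ≡ k + 1 × (∀ d → Yields (Contents (suc i) (d , j)) (along d w)))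
    made j with line j
    ... | w , size≡ , Y =
      w ▸ w′ , trans (size-▸ w w′) (cong (_+ 1) size≡) , λ d →
        subst (Yields _) (sym (along-▸ d w w′))
          (Joining.join (along d w) (along d w′)
            (same-dir (j≢next o j)) (same-dir (j≢next o (next o j))) (same-dir (j≢next² o j))
            (initial d)
            (source-initial {α = d , j} {d , j} ph (here refl) (Y d))
            (tile-initial {β = d , j} ph (here refl)))
      where
      w′ = edge (next o j) (next o (next o j))
      initial : ∀ d {X} → Contents (suc i) (d , j) X → X Is along d w ⊎ X Is along d w′
      initial d {X} X∈ with initial⁻ {β = d , j} ph X∈
      ... | inj₁ (_ , here refl , refl) = inj₂ (_ , λ e → id , id)
      ... | inj₂ (_ , here refl , T)    = inj₁ (proj₂ (Y d) X T)
  advance-spec {m} i s@(lines o []) ph ((k , refl , line) , _) =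
    (_ , _ , w , u , size-w , proj₁ (proj₂ (line zero)) , j≢next o zero , stem , base) , λ
      { (vert  , zero)  → yields-unique (vert , zero) stem
      ; (horiz , zero)  → yields-unique (horiz , zero) base
      ; (vert  , suc j) → empty-unique (vert , suc j) ph refl refl
      ; (horiz , suc j) → empty-unique (horiz , suc j) ph refl refl }
    where
    x = next (not o) zero
    back : ∀ o → next o (next (not o) zero) ≡ zero
    back true  = refl
    back false = refl
    into-zero : Σ[ w ∈ Path x zero ] (size w ≡ k × (∀ d → Yields (Contents i (d , x)) (along d w)))
    into-zero = subst (λ l → Σ[ w ∈ Path x l ] (size w ≡ k × (∀ d → Yields (Contents i (d , x)) (along d w)))) (back o) (line x)
    w      = proj₁ into-zero
    size-w = proj₁ (proj₂ into-zero)
    u      = proj₁ (line zero)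
    corner = edge (vert , zero) (horiz , zero)
    stem : Yields (Contents (suc i) (vert , zero)) (along vert w ▸ corner)
    stem = Joining.join (along vert w) corner (same-dir (λ eq → j≢next (not o) zero (sym eq))) (λ ()) (λ ())
             initial
             (source-initial {α = vert , x} {vert , zero} ph (here refl) (proj₂ (proj₂ into-zero) vert))
             (tile-initial {β = vert , zero} ph (here refl))
      where
      initial : ∀ {X} → Contents (suc i) (vert , zero) X → X Is along vert w ⊎ X Is corner
      initial {X} X∈ with initial⁻ {β = vert , zero} ph X∈
      ... | inj₁ (_ , here refl , refl) = inj₂ (_ , λ e → id , id)
      ... | inj₂ (_ , here refl , T)    = inj₁ (proj₂ (proj₂ (proj₂ into-zero) vert) X T)
    -- The row waits one stage while the corner joins the column, so that no bin has to join more
    -- than two kinds of pieces.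
    base : Yields (Contents (suc i) (horiz , zero)) (along horiz u)
    base = carry (along horiz u) (same-dir (j≢next o zero)) (_ , proj₁ (proj₂ given)) initial
      where
      given = source-initial {α = horiz , zero} {horiz , zero} ph (here refl) (proj₂ (proj₂ (line zero)) horiz)
      initial : ∀ {X} → Contents (suc i) (horiz , zero) X → X Is along horiz u
      initial {X} X∈ with initial⁻ {β = horiz , zero} ph X∈
      ... | inj₂ (_ , here refl , T) = proj₂ (proj₂ (proj₂ (line zero)) horiz) X T
  advance-spec {m} i cornered ph ((x , y , w , u , refl , size≡ , 0≢y , stem , base) , _) =
    (x , y , w , u , size≡ , refl , frame) , λ
      { (vert  , zero)  → yields-unique (vert , zero) frame
      ; (horiz , zero)  → empty-unique (horiz , zero) ph refl refl
      ; (vert  , suc j) → empty-unique (vert , suc j) ph refl refl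
      ; (horiz , suc j) → empty-unique (horiz , suc j) ph refl refl }
    where
    frame : Yields (Contents (suc i) (vert , zero)) (Filling.frame w u size≡)
    frame = Joining.join (along vert w ▸ edge (vert , zero) (horiz , zero)) (along horiz u) (λ ()) (same-dir 0≢y) (λ ())
              initial
              (source-initial {α = vert , zero} {vert , zero} ph (here refl) stem)
              (source-initial {α = horiz , zero} {vert , zero} ph (there (here refl)) base)
      where
      initial : ∀ {X} → Contents (suc i) (vert , zero) X →
                X Is (along vert w ▸ edge (vert , zero) (horiz , zero)) ⊎ X Is along horiz u
      initial {X} X∈ with initial⁻ {β = vert , zero} ph X∈
      ... | inj₂ (_ , here refl , T)         = inj₁ (proj₂ stem X T)
      ... | inj₂ (_ , there (here refl) , T) = inj₂ (proj₂ base X T)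
  advance-spec {m} i framed ph ((x , y , w , u , size≡ , refl , yields) , _) =
    ( terminal-exists , λ X T → let (_ , C) = terminal-complete T in complete-square C , complete-connected C) , λ
      { (vert  , zero)  → λ X Y X∈ Y∈ → complete-≈ᵗ (proj₂ (terminal-complete X∈)) (proj₂ (terminal-complete Y∈))
      ; (horiz , zero)  → empty-unique (horiz , zero) ph refl refl
      ; (vert  , suc j) → empty-unique (vert , suc j) ph refl refl
      ; (horiz , suc j) → empty-unique (horiz , suc j) ph refl refl }
    where
    open Filling w u size≡
    size-positive : ∀ {j k : Fin 3} (w : Path j k) → 0 < size w
    size-positive (edge _ _) = s≤s z≤n
    size-positive (_ ◂ _)    = s≤s z≤n
    initial : ∀ {X} → Contents (suc i) (vert , zero) X → X Is frame ⊎ X ≡ single fillTile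
    initial {X} X∈ with initial⁻ {β = vert , zero} ph X∈
    ... | inj₁ (_ , here refl , X≡) = inj₂ X≡
    ... | inj₂ (_ , here refl , T)  = inj₁ (proj₂ yields X T)
    open Bin {Contents (suc i) (vert , zero)} (size-positive w) (Initial-unique system (suc i) zero) initial
      (initial⁺-tile {β = vert , zero} ph (here refl)) (source-initial {α = vert , zero} {vert , zero} ph (here refl) yields)
  advance-spec i filled ph _ = tt , λ β → empty-unique β ph refl refl
  advance-spec i idle   ph _ = tt , λ β → empty-unique β ph refl refl

  spec : ∀ i → Spec (run 1 ops) i (phase i)
  spec zero    = start
  spec (suc i) = advance-spec i (phase i) refl (spec i)

  phase-lines : ∀ {o} todo {k} → phase k ≡ lines o todo → ∃[ o′ ] phase (length todo + k) ≡ lines o′ []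
  phase-lines {o} []  ph = o , ph
  phase-lines (_ ∷ todo) {k} ph with phase-lines todo {suc k} (cong advance ph)
  ... | o′ , ph′ rewrite ℕₚ.+-suc (length todo) k = o′ , ph′

  phase-final : phase (3 + length ops) ≡ filled
  phase-final with phase-lines ops {0} refl
  ... | _ , ph rewrite ℕₚ.+-identityʳ (length ops) = cong (λ s → advance (advance (advance s))) ph

  final : Holds (run 1 ops) (3 + length ops) filled
  final = subst (Holds (run 1 ops) (3 + length ops)) phase-final (proj₁ (spec (3 + length ops)))

  uniquely-produces : UniquelyProduces system
  uniquely-produces i b _ = subst (λ b → ∀ X Y → Terminal system i b X → Terminal system i b Y → X ≈ᵗ Y)
                              (encode-decode b) (proj₂ (spec i) (decode b))

  output-exists : ∃[ X ] Output system X
  output-exists = let (X , T) = proj₁ final in X , zero , refl , T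

  output-square : ∀ X → Output system X → IsSquare (suc (run 1 ops)) X × FullyConnected G X
  output-square X (zero , _ , T) = proj₂ final X T

  tile-complexity : TileComplexity≤ system 14
  tile-complexity = tileSet , ℕₚ.≤-refl , λ i j t _ t∈ → tilesIn∈tileSet i j t∈

  glue-complexity : GlueComplexity≤ system 4
  glue-complexity = (1 ∷ 2 ∷ 3 ∷ 4 ∷ []) , ℕₚ.≤-refl , λ i j t _ t∈ → All.lookup tileSet-glues (tilesIn∈tileSet i j t∈)

-- Binary expansions

run-++ : ∀ k ops ops′ → run k (ops ++ ops′) ≡ run (run k ops) ops′
run-++ k []                ops′ = refl
run-++ k (double ∷ ops)    ops′ = run-++ (k + k) ops ops′
run-++ k (increment ∷ ops) ops′ = run-++ (k + 1) ops ops′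

halves : ∀ n → ∃[ ops ] (run ⌊ n /2⌋ ops ≡ n × length ops ≤ 2)
halves n with parity n
  where
  parity : ∀ n → n ≡ ⌊ n /2⌋ + ⌊ n /2⌋ ⊎ n ≡ ⌊ n /2⌋ + ⌊ n /2⌋ + 1
  parity zero          = inj₁ refl
  parity (suc zero)    = inj₂ refl
  parity (suc (suc n)) = Sum.map (λ eq → cong suc (trans (cong suc eq) (sym (ℕₚ.+-suc _ _))))
                                 (λ eq → cong suc (trans (cong suc eq) (cong (_+ 1) (sym (ℕₚ.+-suc _ _))))) (parity n)
... | inj₁ eq = double ∷ [] , sym eq , s≤s z≤n
... | inj₂ eq = double ∷ increment ∷ [] , sym eq , ℕₚ.≤-refl

-- Strong induction through the half of `n`: each binary digit after the leading one costs a
-- doubling and at most one increment.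
expansion : ∀ n → 1 ≤ n → ∃[ ops ] (run 1 ops ≡ n × length ops ≤ 2 ℕ.* ⌊log₂ n ⌋)
expansion = <-rec _ go
  where
  go : ∀ n → (∀ {k} → k < n → 1 ≤ k → ∃[ ops ] (run 1 ops ≡ k × length ops ≤ 2 ℕ.* ⌊log₂ k ⌋)) →
       1 ≤ n → ∃[ ops ] (run 1 ops ≡ n × length ops ≤ 2 ℕ.* ⌊log₂ n ⌋)
  go 1 _ _ = [] , refl , z≤n
  go n@(suc (suc n′)) rec _ =
    let (ops , run≡ , bound)    = rec (ℕₚ.⌊n/2⌋<n (suc n′)) (s≤s z≤n)
        (ops′ , run′≡ , bound′) = halves n
    in ops ++ ops′ , trans (run-++ 1 ops ops′) (trans (cong (λ k → run k ops′) run≡) run′≡) , (begin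
      length (ops ++ ops′)          ≡⟨ length-++ ops ⟩
      length ops + length ops′      ≤⟨ ℕₚ.+-mono-≤ bound bound′ ⟩
      2 ℕ.* ⌊log₂ ⌊ n /2⌋ ⌋ + 2     ≡⟨ ℕₚ.+-comm _ 2 ⟩
      2 + 2 ℕ.* ⌊log₂ ⌊ n /2⌋ ⌋     ≡⟨ ℕₚ.*-suc 2 ⌊log₂ ⌊ n /2⌋ ⌋ ⟨
      2 ℕ.* suc ⌊log₂ ⌊ n /2⌋ ⌋     ≡⟨ cong (λ k → 2 ℕ.* suc k) (⌊log₂⌊n/2⌋⌋≡⌊log₂n⌋∸1 n) ⟩
      -- The truncated subtraction is exact, since `n` is at least 2 and its logarithm at least 1.
      2 ℕ.* suc (⌊log₂ n ⌋ ℕ.∸ 1)   ≡⟨ cong (2 ℕ.*_) (ℕₚ.m+[n∸m]≡n (⌊log₂⌋-mono-≤ {2} {n} (s≤s (s≤s z≤n)))) ⟩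
      2 ℕ.* ⌊log₂ n ⌋               ∎)
    where open ℕₚ.≤-Reasoning

-- The square of side 1

module UnitSquare where

  -- For n = 1 the arms of the L would have length 0, which `Path` does not allow. One corner tile
  -- is the square, and it is inert because its two ports differ.
  unit : StagedSystem
  unit = record
    { τ = 2 ; τ-pos = s≤s z≤n
    ; G = G ; G-sym = G-sym ; G-null = G-null ; G-bound = G≤2
    ; stages = 1 ; stages-pos = s≤s z≤n
    ; bins = 1
    ; tilesIn = λ _ _ → cornerTile ∷ []
    ; mix = λ _ _ _ → false
    ; output = λ _ → true }

  corner : Path {Port} (vert , zero) (horiz , zero)
  corner = edge (vert , zero) (horiz , zero)

  yields : ∀ j → Yields (Initial unit 0 j) corner
  yields j = carry corner (λ ()) (_ , cornerTile , here refl , refl) λ { (_ , here refl , refl) → _ , λ e → id , id }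

  unit-square : ∀ X → X Is corner → IsSquare 1 X × FullyConnected G X
  unit-square X (o , X≐) = (-ᴾ o , λ x y → inside , covered) , λ e∈ → east-free e∈ , north-free e∈
    where
    at-o : ∀ {p t} → (p , t) ∈ X → p ≡ o
    at-o e∈ with here refl ← proj₁ (X≐ _) e∈ = refl
    origin : o +ᴾ (-ᴾ o) ≡ (0ℤ , 0ℤ)
    origin = cong₂ _,_ (ℤₚ.+-inverseʳ (proj₁ o)) (ℤₚ.+-inverseʳ (proj₂ o))
    inside : ∀ {x y} → (x , y) ∈ positions (shift (-ᴾ o) X) → (0ℤ ℤ.≤ x × x ℤ.< + 1) × (0ℤ ℤ.≤ y × y ℤ.< + 1)
    inside p∈ with ∈-positions⁻ p∈
    ... | _ , e∈ with ∈-shift⁻ (-ᴾ o) e∈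
    ...   | _ , eq , q∈ with at-o q∈
    ...     | refl with trans eq origin
    ...       | refl = (ℤ.+≤+ z≤n , ℤ.+<+ (s≤s z≤n)) , (ℤ.+≤+ z≤n , ℤ.+<+ (s≤s z≤n))
    covered : ∀ {x y} → (0ℤ ℤ.≤ x × x ℤ.< + 1) × (0ℤ ℤ.≤ y × y ℤ.< + 1) → (x , y) ∈ positions (shift (-ᴾ o) X)
    covered {+ 0} {+ 0} _ = subst (_∈ positions (shift (-ᴾ o) X)) origin
      (∈-positions⁺ (∈-shift⁺ (-ᴾ o) (proj₂ (X≐ (o , cornerTile)) (here refl))))
    covered {+ suc _} ((_ , ℤ.+<+ (s≤s ())) , _)
    covered {+ 0} {+ suc _} (_ , (_ , ℤ.+<+ (s≤s ())))
    east-free : ∀ {x y t s} → ((x , y) , t) ∈ X → ((x ℤ.+ 1ℤ , y) , s) ∈ X → 0 < G (east t) (west s)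
    east-free e∈ f∈ = contradiction (cong proj₁ (trans (at-o e∈) (sym (at-o f∈)))) x≢x+1
    north-free : ∀ {x y t s} → ((x , y) , t) ∈ X → ((x , y ℤ.+ 1ℤ) , s) ∈ X → 0 < G (north t) (south s)
    north-free e∈ f∈ = contradiction (cong proj₂ (trans (at-o e∈) (sym (at-o f∈)))) x≢x+1

theorem1 : ∃[ c ] (∀ (n : ℕ) → 1 ≤ n → ∃[ S ]
    (StagedSystem.τ S ≡ 2
    × UniquelyProduces S
    × (∃[ X ] Output S X)
    × (∀ X → Output S X → IsSquare n X × FullyConnected (StagedSystem.G S) X)
    × StagedSystem.stages S ≤ c * (⌊log₂ n ⌋ + 1)
    × GlueComplexity≤ S 4
    × TileComplexity≤ S 14
    × StagedSystem.bins S ≤ 7))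
-- Four stages come on top of the operations: the initial one, then corner, frame and filling. The
-- operations number at most twice a logarithm, so 4 covers both terms.
theorem1 = 4 , build
  where
  build : ∀ (n : ℕ) → 1 ≤ n → ∃[ S ]
    (StagedSystem.τ S ≡ 2
    × UniquelyProduces S
    × (∃[ X ] Output S X)
    × (∀ X → Output S X → IsSquare n X × FullyConnected (StagedSystem.G S) X)
    × StagedSystem.stages S ≤ 4 * (⌊log₂ n ⌋ + 1)
    × GlueComplexity≤ S 4
    × TileComplexity≤ S 14
    × StagedSystem.bins S ≤ 7)
  build 1 _ =
    unit , refl
    , (λ { zero j _ X Y X∈ Y∈ → Is⇒≈ᵗ {w = corner} (proj₂ (yields j) X X∈) (proj₂ (yields j) Y Y∈)
         ; (suc _) _ (s≤s ()) })
    , (let (X , T) = proj₁ (yields zero) in X , zero , refl , T)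
    , (λ { X (j , _ , T) → unit-square X (proj₂ (yields j) X T) })
    , s≤s z≤n
    , (1 ∷ [] , s≤s z≤n , λ { _ _ _ _ (here refl) →
        inj₂ (here refl) ∷ inj₂ (here refl) ∷ inj₁ refl ∷ inj₁ refl ∷ [] })
    , (cornerTile ∷ [] , s≤s z≤n , λ _ _ _ _ t∈ → t∈)
    , s≤s z≤n
    where open UnitSquare
  build n@(suc m@(suc _)) _ with expansion m (s≤s z≤n)
  ... | ops , run≡ , bound =
    system , refl , uniquely-produces , output-exists
    , subst (λ m → ∀ X → Output system X → IsSquare (suc m) X × FullyConnected G X) run≡ output-square
    , (begin
        4 + length ops              ≤⟨ ℕₚ.+-monoʳ-≤ 4 bound ⟩
        4 + 2 * ⌊log₂ m ⌋           ≤⟨ ℕₚ.+-monoʳ-≤ 4 (ℕₚ.*-mono-≤ {2} {4} (s≤s (s≤s z≤n)) (⌊log₂⌋-mono-≤ (ℕₚ.n≤1+n m))) ⟩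
        4 + 4 * ⌊log₂ n ⌋           ≡⟨ ℕₚ.*-suc 4 ⌊log₂ n ⌋ ⟨
        4 * suc ⌊log₂ n ⌋           ≡⟨ cong (4 *_) (ℕₚ.+-comm ⌊log₂ n ⌋ 1) ⟨
        4 * (⌊log₂ n ⌋ + 1)         ∎)
    , glue-complexity , tile-complexity , ℕₚ.n≤1+n 6
    where
    open System ops
    open ℕₚ.≤-Reasoning
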